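{- Let $k\ge 2$ and let $$P(t)=1+\sum_{n\ge1}\frac{p^{\binom n2}(-t)^n}{[n]_{p,q}!}c_n,\quad G(t)=\sum_{n\ge2}(n-1)\frac{p^{\binom n2}(-t)^n}{[n]_{p,q}!}c_n,\quad H(t)=-\sum_{n\ge3}\binom{n-1}{2}\frac{p^{\binom n2}(-t)^n}{[n]_{p,q}!}c_n,$$ where $c_n=\begin{bmatrix} n+k-1\\ n\end{bmatrix}_r$. Then $$\sum_{n\ge0}\frac{t^n}{[n]_{p,q}!}\sum_{(\sigma,w)\in\mathcal{U}_{n,k}}q^{\mathrm{inv}(\sigma)}p^{\mathrm{coinv}(\sigma)}r^{\|w\|}=\frac{([k]_rt-1)+P(t)-G(t)}{P(t)^2}$$ and $$\sum_{n\ge0}\frac{t^n}{[n]_{p,q}!}\sum_{(\sigma,w)\in\mathcal{V}_{n,k}}q^{\mathrm{inv}(\sigma)}p^{\mathrm{coinv}(\sigma)}r^{\|w\|}=\frac{G(t)^2+P(t)\big(H(t)+G(t)-([k]_rt-1)-P(t)\big)}{P(t)^3}.$$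
   Context: $C_k\wr S_n$ is identified with the set of pairs $(\sigma,w)$, $\sigma\in S_n$, $w=w_1\cdots w_n\in\{0,\dots,k-1\}^n$. The rise set is $\mathrm{Ris}(\sigma,w)=\{i\le n-1:\sigma_i<\sigma_{i+1},\ w_i\le w_{i+1}\}$. $\mathcal{U}_{n,k}$ is the set of $(\sigma,w)\in C_k\wr S_n$ with $\mathrm{Ris}(\sigma,w)=\{s,s+1\}$ for some $1\le s\le n-2$; $\mathcal{V}_{n,k}$ is the set of $(\sigma,w)\in C_k\wr S_n$ with $\mathrm{Ris}(\sigma,w)=\{i,j\}$ for some $i+2\le j$. $\mathrm{inv}(\sigma)=|\{a<b:\sigma_a>\sigma_b\}|$, $\mathrm{coinv}(\sigma)=|\{a<b:\sigma_a<\sigma_b\}|$, $\|w\|=w_1+\cdots+w_n$. $[n]_{p,q}=p^{n-1}+\cdots+q^{n-1}$, $[n]_{p,q}!=[n]_{p,q}\cdots[1]_{p,q}$; $[n]_r=1+r+\cdots+r^{n-1}$, $[k]_r=1+r+\cdots+r^{k-1}$, $[n]_r!=[n]_r\cdots[1]_r$, $\begin{bmatrix} a\\ b\end{bmatrix}_r=\frac{[a]_r!}{[b]_r![a-b]_r!}$. -}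

module Defs where

open import Level using (Level)
open import Data.Bool using (Bool; true; false; if_then_else_; _∧_)
open import Data.Nat as ℕ using (ℕ; zero; suc; _<ᵇ_; _≤ᵇ_; _≡ᵇ_; _∸_)
open import Data.Nat.Combinatorics using (_C_)
open import Data.List using (List; []; _∷_; map; concatMap; filter; upTo; length)
open import Algebra.Bundles using (CommutativeRing)

insertEverywhere : ℕ → List ℕ → List (List ℕ)
insertEverywhere x [] = (x ∷ []) ∷ []
insertEverywhere x (y ∷ ys) = (x ∷ y ∷ ys) ∷ map (y ∷_) (insertEverywhere x ys)

perms : ℕ → List (List ℕ)
perms zero = [] ∷ []
perms (suc n) = concatMap (insertEverywhere (suc n)) (perms n)

words : ℕ → ℕ → List (List ℕ)
words k zero = [] ∷ []
words k (suc n) = concatMap (λ a → map (a ∷_) (words k n)) (upTo k)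

-- elements of C_k ≀ S_n as pairs (σ , w)
record Colored : Set where
  constructor _,_
  field
    perm : List ℕ
    word : List ℕ
open Colored public

wreath : ℕ → ℕ → List Colored
wreath n k = concatMap (λ σ → map (σ ,_) (words k n)) (perms n)

risesFrom : ℕ → List ℕ → List ℕ → List ℕ
risesFrom i (a ∷ b ∷ σ) (x ∷ y ∷ w) =
  if (a <ᵇ b) ∧ (x ≤ᵇ y) then i ∷ risesFrom (suc i) (b ∷ σ) (y ∷ w)
  else risesFrom (suc i) (b ∷ σ) (y ∷ w)
risesFrom i _ _ = []

-- Ris(σ,w) as an increasing list
Ris : Colored → List ℕ
Ris (σ , w) = risesFrom 1 σ w

-- Ris = {s, s+1} (1 ≤ s ≤ n-2 is automatic for rise positions)
isU : List ℕ → Bool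
isU (a ∷ b ∷ []) = b ≡ᵇ suc a
isU _ = false

isV : List ℕ → Bool
isV (a ∷ b ∷ []) = suc (suc a) ≤ᵇ b
isV _ = false

U : ℕ → ℕ → List Colored
U n k = filter (λ x → Data.Bool.T? (isU (Ris x))) (wreath n k)
  where import Data.Bool

V : ℕ → ℕ → List Colored
V n k = filter (λ x → Data.Bool.T? (isV (Ris x))) (wreath n k)
  where import Data.Bool

countGreater : ℕ → List ℕ → ℕ
countGreater a [] = 0
countGreater a (b ∷ l) = (if b <ᵇ a then 1 else 0) ℕ.+ countGreater a l

countLess : ℕ → List ℕ → ℕ
countLess a [] = 0
countLess a (b ∷ l) = (if a <ᵇ b then 1 else 0) ℕ.+ countLess a l

inv : List ℕ → ℕ
inv [] = 0
inv (a ∷ l) = countGreater a l ℕ.+ inv l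

coinv : List ℕ → ℕ
coinv [] = 0
coinv (a ∷ l) = countLess a l ℕ.+ coinv l

norm : List ℕ → ℕ
norm [] = 0
norm (a ∷ l) = a ℕ.+ norm l

module _ {c ℓ : Level} (R : CommutativeRing c ℓ) where
  open CommutativeRing R

  Series : Set c
  Series = ℕ → Carrier

  pow : Carrier → ℕ → Carrier
  pow x zero = 1#
  pow x (suc n) = x * pow x n

  fromℕ : ℕ → Carrier
  fromℕ zero = 0#
  fromℕ (suc n) = 1# + fromℕ n

  sumL : List Carrier → Carrier
  sumL [] = 0#
  sumL (x ∷ l) = x + sumL l

  pqInt : Carrier → Carrier → ℕ → Carrier
  pqInt p q n = sumL (map (λ i → pow p (n ∸ suc i) * pow q i) (upTo n))

  rInt : Carrier → ℕ → Carrier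
  rInt r n = sumL (map (pow r) (upTo n))

  -- Gaussian binomial [a choose b]_r via the r-Pascal recurrence
  -- [a+1 choose b+1]_r = [a choose b]_r + r^{b+1} [a choose b+1]_r
  gauss : Carrier → ℕ → ℕ → Carrier
  gauss r a zero = 1#
  gauss r zero (suc b) = 0#
  gauss r (suc a) (suc b) = gauss r a b + pow r (suc b) * gauss r a (suc b)

  -- 1/[n]_{p,q}! given inverses ib m of [m+1]_{p,q}
  invFact : (ℕ → Carrier) → ℕ → Carrier
  invFact ib zero = 1#
  invFact ib (suc n) = ib n * invFact ib n

  _⊕_ : Series → Series → Series
  (f ⊕ g) n = f n + g n

  _⊖_ : Series → Series → Series
  (f ⊖ g) n = f n - g n

  _⊛_ : Series → Series → Series
  (f ⊛ g) n = sumL (map (λ i → f i * g (n ∸ i)) (upTo (suc n)))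

  -- multiplicative inverse of a series with constant term 1:
  -- g₀ = 1, g_{n} = - Σ_{i=1}^{n} f_i g_{n-i}.
  -- invList f n = g_n ∷ g_{n-1} ∷ ⋯ ∷ g_0
  private
    dot : Series → ℕ → List Carrier → Carrier
    dot f i [] = 0#
    dot f i (x ∷ l) = f i * x + dot f (suc i) l

  invList : Series → ℕ → List Carrier
  invList f zero = 1# ∷ []
  invList f (suc n) = (- dot f 1 (invList f n)) ∷ invList f n

  head0 : List Carrier → Carrier
  head0 [] = 0#
  head0 (x ∷ _) = x

  inverse1 : Series → Series
  inverse1 f n = head0 (invList f n)

  kt-1 : Carrier → ℕ → Series
  kt-1 r k zero = - 1#
  kt-1 r k (suc zero) = rInt r k
  kt-1 r k (suc (suc n)) = 0#

  module Series-defs (k : ℕ) (p q r : Carrier) (ib : ℕ → Carrier) where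

    cc : ℕ → Carrier
    cc n = gauss r (n ℕ.+ k ∸ 1) n

    base : ℕ → Carrier
    base n = pow p (n C 2) * pow (- 1#) n * invFact ib n * cc n

    P : Series
    P zero = 1#
    P (suc n) = base (suc n)

    G : Series
    G zero = 0#
    G (suc zero) = 0#
    G (suc (suc n)) = fromℕ (suc n) * base (suc (suc n))

    H : Series
    H zero = 0#
    H (suc zero) = 0#
    H (suc (suc zero)) = 0#
    H (suc (suc (suc n))) = - (fromℕ (suc (suc n) C 2) * base (suc (suc (suc n))))

    weight : Colored → Carrier
    weight (σ , w) = pow q (inv σ) * pow p (coinv σ) * pow r (norm w)

    GU : Series
    GU n = invFact ib n * sumL (map weight (U n k))

    GV : Series
    GV n = invFact ib n * sumL (map weight (V n k))

    Pinv : Series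
    Pinv = inverse1 P

    RU : Series
    RU = ((kt-1 r k ⊕ P) ⊖ G) ⊛ (Pinv ⊛ Pinv)

    RV : Series
    RV = ((G ⊛ G) ⊕ (P ⊛ (((H ⊕ G) ⊖ kt-1 r k) ⊖ P))) ⊛ (Pinv ⊛ (Pinv ⊛ Pinv))

{-# OPTIONS --safe #-}
module Submission where

-- Prescribing that the first b letters of (σ , w) form a run of rises, with no condition on the step
-- leaving the run, splits off the factor p^(b choose 2) c_b / [b]! from the exponential generating
-- function. Hence the operator "leadingRuns c" on functions of the rise pattern (a boolean per
-- position), which takes the alternating sum of such splittings with weights c, acts on generating
-- functions as multiplication by a signed weighted sum of these factors; for constant weights this
-- is multiplication by 1 - P. Writing none, one, adjacent, separated for the indicators of no rise,
-- one rise, and the two kinds of two rises, an induction on the pattern expresses each of them as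
-- its own leadingRuns plus leadingRuns (with the weights of G and H) of a simpler one, i.e.
--   P none = 1,  P one = G none,  P adjacent = A none,  P separated = G one + (H - A) none
-- with A = ([k]_r t - 1) + P - G, and the theorem follows by division by P.

open import Defs
open import Algebra.Bundles using (CommutativeRing; CommutativeSemiring)
import Algebra.Properties.Ring
import Algebra.Solver.Ring.NaturalCoefficients.Default
open import Algebra.Structures.Biased using (isCommutativeSemiringˡ)
open import Data.Bool using (Bool; true; false; if_then_else_; _∧_; T?)
open import Data.Bool.Properties using (if-eta)
open import Data.List using (List; []; _∷_; map; length; concatMap; _++_; filter; upTo)
open import Data.List.Properties using (map-∘; map-upTo; map-applyUpTo; length-map)
open import Data.List.Relation.Binary.Permutation.Propositional as ↭ using (_↭_)
open import Data.List.Relation.Binary.Permutation.Propositional.Properties using (All-resp-↭; ↭-length)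
open import Data.List.Relation.Unary.All as All using (All; []; _∷_)
import Data.List.Relation.Unary.All.Properties as All
open import Data.Nat as ℕ using (ℕ; zero; suc; _≤_; _<_; _<ᵇ_; _≤ᵇ_; _≡ᵇ_; _∸_; z≤n; s≤s)
open import Data.Nat.Combinatorics using (_C_; nC1≡n; nCk+nC[k+1]≡[n+1]C[k+1])
import Data.Nat.Properties as ℕ
open import Data.Product using (_×_; _,_)
open import Function using (_∘_)
open import Level using (Level)
open import Relation.Binary.PropositionalEquality as ≡ using (_≡_; cong; cong₂)
import Relation.Binary.Reasoning.Setoid
open import Relation.Binary.Structures using (IsEquivalence)
open import Algebra.Properties.CommutativeSemigroup ℕ.+-commutativeSemigroup using (x∙yz≈y∙xz)

-- Rise sets as boolean patterns.

ris : List ℕ → List ℕ → List Bool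
ris (a ∷ b ∷ σ) (x ∷ y ∷ w) = ((a <ᵇ b) ∧ (x ≤ᵇ y)) ∷ ris (b ∷ σ) (y ∷ w)
ris _ _ = []

positions : ℕ → List Bool → List ℕ
positions i [] = []
positions i (true ∷ l) = i ∷ positions (suc i) l
positions i (false ∷ l) = positions (suc i) l

risesFrom-positions : ∀ i σ w → risesFrom i σ w ≡ positions i (ris σ w)
risesFrom-positions i [] w = ≡.refl
risesFrom-positions i (a ∷ []) w = ≡.refl
risesFrom-positions i (a ∷ b ∷ σ) [] = ≡.refl
risesFrom-positions i (a ∷ b ∷ σ) (x ∷ []) = ≡.refl
risesFrom-positions i (a ∷ b ∷ σ) (x ∷ y ∷ w) = ≡.trans
  (cong (λ z → if rise then i ∷ z else z) (risesFrom-positions (suc i) (b ∷ σ) (y ∷ w)))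
  (if-positions rise)
  where
  rise = (a <ᵇ b) ∧ (x ≤ᵇ y)
  tail = ris (b ∷ σ) (y ∷ w)
  if-positions : ∀ s → (if s then i ∷ positions (suc i) tail else positions (suc i) tail) ≡ positions i (s ∷ tail)
  if-positions true = ≡.refl
  if-positions false = ≡.refl

-- `firstRiseOnly` and `laterRiseOnly` split `oneRise` by whether the rise is at the first position.
-- They describe what may follow the first of two adjacent or separated rises.
noRise oneRise firstRiseOnly laterRiseOnly adjacentRises separatedRises : List Bool → Bool
noRise [] = true
noRise (true ∷ l) = false
noRise (false ∷ l) = noRise l
oneRise [] = false
oneRise (true ∷ l) = noRise l
oneRise (false ∷ l) = oneRise l
firstRiseOnly [] = false
firstRiseOnly (true ∷ l) = noRise l
firstRiseOnly (false ∷ l) = false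
laterRiseOnly [] = false
laterRiseOnly (true ∷ l) = false
laterRiseOnly (false ∷ l) = oneRise l
adjacentRises [] = false
adjacentRises (true ∷ l) = firstRiseOnly l
adjacentRises (false ∷ l) = adjacentRises l
separatedRises [] = false
separatedRises (true ∷ l) = laterRiseOnly l
separatedRises (false ∷ l) = separatedRises l

private
  ≡ᵇ-refl : ∀ n → (n ≡ᵇ n) ≡ true
  ≡ᵇ-refl zero = ≡.refl
  ≡ᵇ-refl (suc n) = ≡ᵇ-refl n

  >⇒≢ᵇ : ∀ {m n} → n < m → (m ≡ᵇ n) ≡ false
  >⇒≢ᵇ {suc m} {zero} _ = ≡.refl
  >⇒≢ᵇ {suc m} {suc n} (s≤s n<m) = >⇒≢ᵇ n<m

  ≤⇒≤ᵇ≡true : ∀ {m n} → m ≤ n → (m ≤ᵇ n) ≡ true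
  ≤⇒≤ᵇ≡true z≤n = ≡.refl
  ≤⇒≤ᵇ≡true {suc zero} (s≤s z≤n) = ≡.refl
  ≤⇒≤ᵇ≡true {suc (suc m)} (s≤s m≤n) = ≤⇒≤ᵇ≡true m≤n

  sucn≰ᵇn : ∀ n → (suc n ≤ᵇ n) ≡ false
  sucn≰ᵇn zero = ≡.refl
  sucn≰ᵇn (suc n) = sucn≰ᵇn n

-- All entries of `positions i l` are at least `i`, so none of them can be `suc a`.
isU-∷-positions : ∀ a i l → suc a < i → isU (a ∷ positions i l) ≡ false
isU-∷-positions a i [] _ = ≡.refl
isU-∷-positions a i (false ∷ l) a<i = isU-∷-positions a (suc i) l (ℕ.m<n⇒m<1+n a<i)
isU-∷-positions a i (true ∷ l) a<i with positions (suc i) l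
... | [] = >⇒≢ᵇ a<i
... | _ ∷ _ = ≡.refl

-- Once two positions are fixed, `isU` and `isV` only ask whether there are further ones, and
-- `positions i l` is empty exactly when `noRise l` holds.
case-noRise : ∀ {A : Set} (a b : A) i l (f : List ℕ → A) → f [] ≡ a → (∀ x y → f (x ∷ y) ≡ b) →
  f (positions i l) ≡ (if noRise l then a else b)
case-noRise a b i [] f f[] f∷ = f[]
case-noRise a b i (true ∷ l) f f[] f∷ = f∷ _ _
case-noRise a b i (false ∷ l) f f[] f∷ = case-noRise a b (suc i) l f f[] f∷

private
  if-true-false : ∀ b → (if b then true else false) ≡ b
  if-true-false true = ≡.refl
  if-true-false false = ≡.refl

isU-positions : ∀ i l → isU (positions i l) ≡ adjacentRises l
isU-positions i [] = ≡.refl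
isU-positions i (false ∷ l) = isU-positions (suc i) l
isU-positions i (true ∷ []) = ≡.refl
isU-positions i (true ∷ false ∷ l) = isU-∷-positions i (suc (suc i)) l ℕ.≤-refl
isU-positions i (true ∷ true ∷ l) = ≡.trans
  (case-noRise true false (suc (suc i)) l (λ z → isU (i ∷ suc i ∷ z)) (≡ᵇ-refl i) (λ _ _ → ≡.refl))
  (if-true-false (noRise l))

isV-∷-positions : ∀ a i l → suc a < i → isV (a ∷ positions i l) ≡ oneRise l
isV-∷-positions a i [] _ = ≡.refl
isV-∷-positions a i (false ∷ l) a<i = isV-∷-positions a (suc i) l (ℕ.m<n⇒m<1+n a<i)
isV-∷-positions a i (true ∷ l) a<i = ≡.trans
  (case-noRise true false (suc i) l (λ z → isV (a ∷ i ∷ z)) (≤⇒≤ᵇ≡true a<i) (λ _ _ → ≡.refl))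
  (if-true-false (noRise l))

isV-positions : ∀ i l → isV (positions i l) ≡ separatedRises l
isV-positions i [] = ≡.refl
isV-positions i (false ∷ l) = isV-positions (suc i) l
isV-positions i (true ∷ []) = ≡.refl
isV-positions i (true ∷ false ∷ l) = isV-∷-positions i (suc (suc i)) l ℕ.≤-refl
isV-positions i (true ∷ true ∷ l) = ≡.trans
  (case-noRise false false (suc (suc i)) l (λ z → isV (i ∷ suc i ∷ z)) (sucn≰ᵇn i) (λ _ _ → ≡.refl))
  (if-eta (noRise l))

-- Removing the first letter of a permutation.

-- lift j makes room for the value suc j among positive values
lift : ℕ → ℕ → ℕ
lift j zero = zero
lift zero (suc a) = suc (suc a)
lift (suc j) (suc a) = suc (lift j a)

lift-<ᵇ : ∀ j a b → (lift j a <ᵇ lift j b) ≡ (a <ᵇ b)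
lift-<ᵇ j zero zero = ≡.refl
lift-<ᵇ zero zero (suc b) = ≡.refl
lift-<ᵇ (suc j) zero (suc b) = ≡.refl
lift-<ᵇ j (suc a) zero = ≡.refl
lift-<ᵇ zero (suc a) (suc b) = ≡.refl
lift-<ᵇ (suc j) (suc a) (suc b) = lift-<ᵇ j a b

-- `lift j` fixes the values up to `j` and moves the larger ones above `suc j`; hence above `suc j`
-- afterwards means above `j` before. The opposite comparison in `lift<ᵇsuc` keeps its bound.
suc<ᵇlift : ∀ j a → (suc j <ᵇ lift j a) ≡ (j <ᵇ a)
suc<ᵇlift j zero = ≡.refl
suc<ᵇlift zero (suc a) = ≡.refl
suc<ᵇlift (suc j) (suc a) = suc<ᵇlift j a

lift<ᵇsuc : ∀ j a → (lift j a <ᵇ suc j) ≡ (a <ᵇ suc j)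
lift<ᵇsuc j zero = ≡.refl
lift<ᵇsuc zero (suc a) = ≡.refl
lift<ᵇsuc (suc j) (suc a) = lift<ᵇsuc j a

lift-≤ : ∀ {j a} → a ≤ j → lift j a ≡ a
lift-≤ z≤n = ≡.refl
lift-≤ (s≤s a≤j) = cong suc (lift-≤ a≤j)

lift-> : ∀ {j a} → j < a → lift j a ≡ suc a
lift-> {zero} {suc a} _ = ≡.refl
lift-> {suc j} {suc a} (s≤s j<a) = cong suc (lift-> j<a)

ris-lift : ∀ j σ w → ris (map (lift j) σ) w ≡ ris σ w
ris-lift j [] w = ≡.refl
ris-lift j (a ∷ []) w = ≡.refl
ris-lift j (a ∷ b ∷ σ) [] = ≡.refl
ris-lift j (a ∷ b ∷ σ) (x ∷ []) = ≡.refl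
ris-lift j (a ∷ b ∷ σ) (x ∷ y ∷ w) =
  cong₂ (λ s l → (s ∧ (x ≤ᵇ y)) ∷ l) (lift-<ᵇ j a b) (ris-lift j (b ∷ σ) (y ∷ w))

countGreater-lift : ∀ j a σ → countGreater (lift j a) (map (lift j) σ) ≡ countGreater a σ
countGreater-lift j a [] = ≡.refl
countGreater-lift j a (b ∷ σ) =
  cong₂ (λ s l → (if s then 1 else 0) ℕ.+ l) (lift-<ᵇ j b a) (countGreater-lift j a σ)

countLess-lift : ∀ j a σ → countLess (lift j a) (map (lift j) σ) ≡ countLess a σ
countLess-lift j a [] = ≡.refl
countLess-lift j a (b ∷ σ) =
  cong₂ (λ s l → (if s then 1 else 0) ℕ.+ l) (lift-<ᵇ j a b) (countLess-lift j a σ)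

inv-lift : ∀ j σ → inv (map (lift j) σ) ≡ inv σ
inv-lift j [] = ≡.refl
inv-lift j (a ∷ σ) = cong₂ ℕ._+_ (countGreater-lift j a σ) (inv-lift j σ)

coinv-lift : ∀ j σ → coinv (map (lift j) σ) ≡ coinv σ
coinv-lift j [] = ≡.refl
coinv-lift j (a ∷ σ) = cong₂ ℕ._+_ (countLess-lift j a σ) (coinv-lift j σ)

countGreater-suc-lift : ∀ j σ → countGreater (suc j) (map (lift j) σ) ≡ countGreater (suc j) σ
countGreater-suc-lift j [] = ≡.refl
countGreater-suc-lift j (b ∷ σ) =
  cong₂ (λ s l → (if s then 1 else 0) ℕ.+ l) (lift<ᵇsuc j b) (countGreater-suc-lift j σ)

countLess-suc-lift : ∀ j σ → countLess (suc j) (map (lift j) σ) ≡ countLess j σ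
countLess-suc-lift j [] = ≡.refl
countLess-suc-lift j (b ∷ σ) =
  cong₂ (λ s l → (if s then 1 else 0) ℕ.+ l) (suc<ᵇlift j b) (countLess-suc-lift j σ)

countGreater-↭ : ∀ a {σ τ} → σ ↭ τ → countGreater a σ ≡ countGreater a τ
countGreater-↭ a ↭.refl = ≡.refl
countGreater-↭ a (↭.prep x s) = cong (_ ℕ.+_) (countGreater-↭ a s)
countGreater-↭ a (↭.swap x y s) = ≡.trans (x∙yz≈y∙xz (if x <ᵇ a then 1 else 0) (if y <ᵇ a then 1 else 0) _)
  (cong (λ z → (if y <ᵇ a then 1 else 0) ℕ.+ ((if x <ᵇ a then 1 else 0) ℕ.+ z)) (countGreater-↭ a s))
countGreater-↭ a (↭.trans s t) = ≡.trans (countGreater-↭ a s) (countGreater-↭ a t)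

countLess-↭ : ∀ a {σ τ} → σ ↭ τ → countLess a σ ≡ countLess a τ
countLess-↭ a ↭.refl = ≡.refl
countLess-↭ a (↭.prep x s) = cong (_ ℕ.+_) (countLess-↭ a s)
countLess-↭ a (↭.swap x y s) = ≡.trans (x∙yz≈y∙xz (if a <ᵇ x then 1 else 0) (if a <ᵇ y then 1 else 0) _)
  (cong (λ z → (if a <ᵇ y then 1 else 0) ℕ.+ ((if a <ᵇ x then 1 else 0) ℕ.+ z)) (countLess-↭ a s))
countLess-↭ a (↭.trans s t) = ≡.trans (countLess-↭ a s) (countLess-↭ a t)

-- A reference arrangement of 1, ..., n. The number of letters above or below a given value is
-- invariant under `↭`, so it can be read off here for every list in `perms n`.
decreasing : ℕ → List ℕ
decreasing zero = []
decreasing (suc n) = suc n ∷ decreasing n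

insertEverywhere-↭ : ∀ x σ → All (_↭ x ∷ σ) (insertEverywhere x σ)
insertEverywhere-↭ x [] = ↭.refl ∷ []
insertEverywhere-↭ x (y ∷ σ) = ↭.refl ∷ All.map⁺ (All.map
  (λ s → ↭.trans (↭.prep y s) (↭.swap y x ↭.refl)) (insertEverywhere-↭ x σ))

perms-↭ : ∀ n → All (_↭ decreasing n) (perms n)
perms-↭ zero = ↭.refl ∷ []
perms-↭ (suc n) = All.concat⁺ (All.map⁺ (All.map
  (λ {σ} s → All.map (λ t → ↭.trans t (↭.prep (suc n) s)) (insertEverywhere-↭ (suc n) σ)) (perms-↭ n)))

length-decreasing : ∀ n → length (decreasing n) ≡ n
length-decreasing zero = ≡.refl
length-decreasing (suc n) = cong suc (length-decreasing n)

decreasing-≤ : ∀ n → All (_≤ n) (decreasing n)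
decreasing-≤ zero = []
decreasing-≤ (suc n) = ℕ.≤-refl ∷ All.map ℕ.m≤n⇒m≤1+n (decreasing-≤ n)

countGreater-decreasing : ∀ j n → countGreater (suc j) (decreasing n) ≡ j ℕ.⊓ n
countGreater-decreasing j zero = ≡.sym (ℕ.⊓-zeroʳ j)
countGreater-decreasing j (suc n) =
  ≡.trans (cong ((if n <ᵇ j then 1 else 0) ℕ.+_) (countGreater-decreasing j n)) (step j n)
  where
  step : ∀ j n → (if n <ᵇ j then 1 else 0) ℕ.+ (j ℕ.⊓ n) ≡ j ℕ.⊓ suc n
  step zero n = ≡.refl
  step (suc j) zero = cong suc (≡.sym (ℕ.⊓-zeroʳ j))
  step (suc j) (suc n) = ≡.trans (ℕ.+-suc _ (j ℕ.⊓ n)) (cong suc (step j n))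

countLess-decreasing : ∀ j n → countLess j (decreasing n) ≡ n ∸ j
countLess-decreasing j zero = ≡.sym (ℕ.0∸n≡0 j)
countLess-decreasing j (suc n) =
  ≡.trans (cong ((if j <ᵇ suc n then 1 else 0) ℕ.+_) (countLess-decreasing j n)) (step j n)
  where
  step : ∀ j n → (if j <ᵇ suc n then 1 else 0) ℕ.+ (n ∸ j) ≡ suc n ∸ j
  step zero n = ≡.refl
  step (suc j) zero = ≡.sym (ℕ.0∸n≡0 j)
  step (suc j) (suc n) = step j n

-- `suc j` is followed by exactly `j` smaller letters, and `lift j` preserves the order of the rest.
inv-first : ∀ {j n σ} → j ≤ n → σ ↭ decreasing n → inv (suc j ∷ map (lift j) σ) ≡ j ℕ.+ inv σ
inv-first {j} {n} {σ} j≤n s = cong₂ ℕ._+_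
  (≡.trans (countGreater-suc-lift j σ) (≡.trans (countGreater-↭ (suc j) s)
    (≡.trans (countGreater-decreasing j n) (ℕ.m≤n⇒m⊓n≡m j≤n))))
  (inv-lift j σ)

coinv-first : ∀ {j n σ} → σ ↭ decreasing n → coinv (suc j ∷ map (lift j) σ) ≡ (n ∸ j) ℕ.+ coinv σ
coinv-first {j} {n} {σ} s = cong₂ ℕ._+_
  (≡.trans (countLess-suc-lift j σ) (≡.trans (countLess-↭ j s) (countLess-decreasing j n)))
  (coinv-lift j σ)

length-perm : ∀ {n σ} → σ ↭ decreasing n → length σ ≡ n
length-perm {n} s = ≡.trans (↭-length s) (length-decreasing n)

map-lift-perm : ∀ {n σ} → σ ↭ decreasing n → map (lift n) σ ≡ σ
map-lift-perm {n} s = go (All-resp-↭ (↭.↭-sym s) (decreasing-≤ n))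
  where
  go : ∀ {σ} → All (_≤ n) σ → map (lift n) σ ≡ σ
  go [] = ≡.refl
  go (a≤n ∷ l) = cong₂ _∷_ (lift-≤ a≤n) (go l)

insertEverywhere-map : ∀ (f : ℕ → ℕ) x σ → insertEverywhere (f x) (map f σ) ≡ map (map f) (insertEverywhere x σ)
insertEverywhere-map f x [] = ≡.refl
insertEverywhere-map f x (y ∷ σ) = cong ((f x ∷ f y ∷ map f σ) ∷_)
  (≡.trans (cong (map (f y ∷_)) (insertEverywhere-map f x σ))
    (≡.trans (≡.sym (map-∘ (insertEverywhere x σ))) (map-∘ (insertEverywhere x σ))))

-- Finite sums, and sums over permutations by first letter.

module Sums {c ℓ} (R : CommutativeRing c ℓ) where
  open CommutativeRing R hiding (zero)
  open Relation.Binary.Reasoning.Setoid setoid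
  open Algebra.Solver.Ring.NaturalCoefficients.Default commutativeSemiring
    using (solve; _:=_; _:+_; _:*_; con)

  ∑ : {A : Set} → List A → (A → Carrier) → Carrier
  ∑ xs f = sumL R (map f xs)

  ∑-cong-All : ∀ {A : Set} {xs : List A} {f g} → All (λ x → f x ≈ g x) xs → ∑ xs f ≈ ∑ xs g
  ∑-cong-All [] = refl
  ∑-cong-All (e ∷ es) = +-cong e (∑-cong-All es)

  ∑-cong : ∀ {A : Set} (xs : List A) {f g} → (∀ x → f x ≈ g x) → ∑ xs f ≈ ∑ xs g
  ∑-cong xs e = ∑-cong-All (All.universal e xs)

  ∑-0 : ∀ {A : Set} (xs : List A) → ∑ xs (λ _ → 0#) ≈ 0#
  ∑-0 [] = refl
  ∑-0 (x ∷ xs) = trans (+-identityˡ _) (∑-0 xs)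

  ∑-+ : ∀ {A : Set} (xs : List A) f g → ∑ xs (λ x → f x + g x) ≈ ∑ xs f + ∑ xs g
  ∑-+ [] f g = sym (+-identityˡ 0#)
  ∑-+ (x ∷ xs) f g = trans (+-congˡ (∑-+ xs f g))
    (solve 4 (λ a b s t → (a :+ b) :+ (s :+ t) := (a :+ s) :+ (b :+ t)) refl (f x) (g x) (∑ xs f) (∑ xs g))

  *-∑ : ∀ {A : Set} a (xs : List A) f → a * ∑ xs f ≈ ∑ xs (λ x → a * f x)
  *-∑ a [] f = zeroʳ a
  *-∑ a (x ∷ xs) f = trans (distribˡ a _ _) (+-congˡ (*-∑ a xs f))

  ∑-* : ∀ {A : Set} (xs : List A) f a → ∑ xs f * a ≈ ∑ xs (λ x → f x * a)
  ∑-* [] f a = zeroˡ a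
  ∑-* (x ∷ xs) f a = trans (distribʳ a _ _) (+-congˡ (∑-* xs f a))

  ∑-swap : ∀ {A B : Set} (xs : List A) (ys : List B) (f : A → B → Carrier) →
    ∑ xs (λ x → ∑ ys (f x)) ≈ ∑ ys (λ y → ∑ xs (λ x → f x y))
  ∑-swap [] ys f = sym (∑-0 ys)
  ∑-swap (x ∷ xs) ys f = trans (+-congˡ (∑-swap xs ys f)) (sym (∑-+ ys (f x) _))

  ∑-++ : ∀ {A : Set} (xs ys : List A) f → ∑ (xs ++ ys) f ≈ ∑ xs f + ∑ ys f
  ∑-++ [] ys f = sym (+-identityˡ _)
  ∑-++ (x ∷ xs) ys f = trans (+-congˡ (∑-++ xs ys f)) (sym (+-assoc _ _ _))

  ∑-map : ∀ {A B : Set} (g : A → B) xs f → ∑ (map g xs) f ≈ ∑ xs (f ∘ g)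
  ∑-map g xs f = reflexive (≡.cong (sumL R) (≡.sym (map-∘ xs)))

  ∑-concatMap : ∀ {A B : Set} (g : A → List B) xs f → ∑ (concatMap g xs) f ≈ ∑ xs (λ x → ∑ (g x) f)
  ∑-concatMap g [] f = refl
  ∑-concatMap g (x ∷ xs) f = trans (∑-++ (g x) (concatMap g xs) f) (+-congˡ (∑-concatMap g xs f))

  ∑-upTo-suc : ∀ n f → ∑ (upTo (suc n)) f ≈ f 0 + ∑ (upTo n) (f ∘ suc)
  ∑-upTo-suc n f = +-congˡ (reflexive (≡.cong (sumL R)
    (≡.trans (map-applyUpTo suc f n) (≡.sym (map-upTo (f ∘ suc) n)))))

  ∑-upTo-last : ∀ n f → ∑ (upTo (suc n)) f ≈ ∑ (upTo n) f + f n
  ∑-upTo-last zero f = +-comm _ _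
  ∑-upTo-last (suc n) f = begin
    ∑ (upTo (suc (suc n))) f              ≈⟨ ∑-upTo-suc (suc n) f ⟩
    f 0 + ∑ (upTo (suc n)) (f ∘ suc)      ≈⟨ +-congˡ (∑-upTo-last n (f ∘ suc)) ⟩
    f 0 + (∑ (upTo n) (f ∘ suc) + f (suc n)) ≈⟨ +-assoc _ _ _ ⟨
    f 0 + ∑ (upTo n) (f ∘ suc) + f (suc n)   ≈⟨ +-congʳ (∑-upTo-suc n f) ⟨
    ∑ (upTo (suc n)) f + f (suc n)        ∎

  ∑-upTo-cong : ∀ n {f g} → (∀ i → i < n → f i ≈ g i) → ∑ (upTo n) f ≈ ∑ (upTo n) g
  ∑-upTo-cong zero e = refl
  ∑-upTo-cong (suc n) {f} {g} e = begin
    ∑ (upTo (suc n)) f           ≈⟨ ∑-upTo-suc n f ⟩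
    f 0 + ∑ (upTo n) (f ∘ suc)   ≈⟨ +-cong (e 0 (s≤s z≤n)) (∑-upTo-cong n (λ i i<n → e (suc i) (s≤s i<n))) ⟩
    g 0 + ∑ (upTo n) (g ∘ suc)   ≈⟨ ∑-upTo-suc n g ⟨
    ∑ (upTo (suc n)) g           ∎

  ⟦_⟧ : Bool → Carrier
  ⟦ true ⟧ = 1#
  ⟦ false ⟧ = 0#

  ⟦⟧-∧ : ∀ a b → ⟦ a ∧ b ⟧ ≈ ⟦ a ⟧ * ⟦ b ⟧
  ⟦⟧-∧ true b = sym (*-identityˡ _)
  ⟦⟧-∧ false b = sym (zeroˡ _)

  ∑-filter : ∀ {A : Set} (b : A → Bool) xs f →
    ∑ (filter (λ x → T? (b x)) xs) f ≈ ∑ xs (λ x → f x * ⟦ b x ⟧)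
  ∑-filter b [] f = refl
  ∑-filter b (x ∷ xs) f with b x
  ... | true = +-cong (sym (*-identityʳ _)) (∑-filter b xs f)
  ... | false = trans (∑-filter b xs f) (trans (sym (+-identityˡ _)) (+-congʳ (sym (zeroʳ _))))

  -- The indicator keeps the indices from `j` on, where `f i` is the decrease of `F` from `i` to
  -- `suc i`; the vanishing of `F n` removes the upper boundary term.
  ∑-telescope : ∀ n j {F f : ℕ → Carrier} → (∀ i → i < n → F i ≈ f i + F (suc i)) → F n ≈ 0# → j ≤ n →
    ∑ (upTo n) (λ i → ⟦ j <ᵇ suc i ⟧ * f i) ≈ F j
  ∑-telescope zero zero step end _ = sym end
  ∑-telescope (suc n) zero {F} {f} step end _ = begin
    ∑ (upTo (suc n)) (λ i → 1# * f i)            ≈⟨ ∑-upTo-suc n (λ i → 1# * f i) ⟩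
    1# * f 0 + ∑ (upTo n) (λ i → 1# * f (suc i)) ≈⟨ +-cong (*-identityˡ _) (∑-telescope n zero {F ∘ suc} (λ i i<n → step (suc i) (s≤s i<n)) end z≤n) ⟩
    f 0 + F 1                                    ≈⟨ step 0 (s≤s z≤n) ⟨
    F 0                                          ∎
  ∑-telescope (suc n) (suc j) {F} {f} step end (s≤s j≤n) = begin
    ∑ (upTo (suc n)) (λ i → ⟦ suc j <ᵇ suc i ⟧ * f i)     ≈⟨ ∑-upTo-suc n (λ i → ⟦ suc j <ᵇ suc i ⟧ * f i) ⟩
    0# * f 0 + ∑ (upTo n) (λ i → ⟦ j <ᵇ suc i ⟧ * f (suc i))
      ≈⟨ +-cong (zeroˡ _) (∑-telescope n j {F ∘ suc} (λ i i<n → step (suc i) (s≤s i<n)) end j≤n) ⟩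
    0# + F (suc j)                                        ≈⟨ +-identityˡ _ ⟩
    F (suc j)                                             ∎

  ∑-insertEverywhere-map : ∀ (g : ℕ → ℕ) x σ f →
    ∑ (insertEverywhere (g x) (map g σ)) f ≈ ∑ (insertEverywhere x σ) (f ∘ map g)
  ∑-insertEverywhere-map g x σ f =
    trans (reflexive (≡.cong (λ l → ∑ l f) (insertEverywhere-map g x σ))) (∑-map (map g) (insertEverywhere x σ) f)

  -- `perms` inserts the largest value, while the recursions below remove the first letter.
  -- Insertion behind the first letter commutes with `lift j`; insertion in front supplies the one
  -- missing first letter `suc (suc n)`, where `lift (suc n)` acts as the identity.
  ∑-perms-first : ∀ n (f : List ℕ → Carrier) →
    ∑ (perms (suc n)) f ≈ ∑ (upTo (suc n)) (λ j → ∑ (perms n) (λ σ → f (suc j ∷ map (lift j) σ)))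
  ∑-perms-first zero f = sym (+-identityʳ _)
  ∑-perms-first (suc n) f = begin
    ∑ (perms (suc (suc n))) f
      ≈⟨ ∑-concatMap (insertEverywhere (suc (suc n))) (perms (suc n)) f ⟩
    ∑ (perms (suc n)) inserted
      ≈⟨ ∑-perms-first n inserted ⟩
    ∑ (upTo (suc n)) (λ j → ∑ (perms n) (λ σ → inserted (suc j ∷ map (lift j) σ)))
      ≈⟨ ∑-cong (upTo (suc n)) (λ j → ∑-+ (perms n) (λ σ → f (suc (suc n) ∷ suc j ∷ map (lift j) σ)) _) ⟩
    ∑ (upTo (suc n)) (λ j → ∑ (perms n) (λ σ → f (suc (suc n) ∷ suc j ∷ map (lift j) σ)) + later j)
      ≈⟨ ∑-+ (upTo (suc n)) _ later ⟩
    ∑ (upTo (suc n)) (λ j → ∑ (perms n) (λ σ → f (suc (suc n) ∷ suc j ∷ map (lift j) σ))) + ∑ (upTo (suc n)) later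
      -- The induction hypothesis is used a second time, in reverse, to recombine the front
      -- insertions into one sum over `perms (suc n)`.
      ≈⟨ +-cong (sym (∑-perms-first n (λ σ → f (suc (suc n) ∷ σ)))) (∑-upTo-cong (suc n) later≈) ⟩
    ∑ (perms (suc n)) (λ σ → f (suc (suc n) ∷ σ)) + ∑ (upTo (suc n)) first
      ≈⟨ +-comm _ _ ⟩
    ∑ (upTo (suc n)) first + ∑ (perms (suc n)) (λ σ → f (suc (suc n) ∷ σ))
      ≈⟨ +-congˡ (∑-cong-All (All.map (λ s → reflexive (≡.cong (λ σ → f (suc (suc n) ∷ σ)) (≡.sym (map-lift-perm s)))) (perms-↭ (suc n)))) ⟩
    ∑ (upTo (suc n)) first + first (suc n)
      ≈⟨ ∑-upTo-last (suc n) first ⟨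
    ∑ (upTo (suc (suc n))) first ∎
    where
    inserted : List ℕ → Carrier
    inserted σ = ∑ (insertEverywhere (suc (suc n)) σ) f
    later first : ℕ → Carrier
    later j = ∑ (perms n) (λ σ → ∑ (map (suc j ∷_) (insertEverywhere (suc (suc n)) (map (lift j) σ))) f)
    first j = ∑ (perms (suc n)) (λ σ → f (suc j ∷ map (lift j) σ))
    later≈ : ∀ j → j < suc n → later j ≈ first j
    later≈ j j<1+n = begin
      later j
        ≈⟨ ∑-cong (perms n) (λ σ → ∑-map (suc j ∷_) (insertEverywhere (suc (suc n)) (map (lift j) σ)) f) ⟩
      ∑ (perms n) (λ σ → ∑ (insertEverywhere (suc (suc n)) (map (lift j) σ)) (λ τ → f (suc j ∷ τ)))
        -- As `j < suc n`, the inserted value is itself a lifted one.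
        ≈⟨ ∑-cong (perms n) (λ σ → reflexive (≡.cong (λ m → ∑ (insertEverywhere m (map (lift j) σ)) (λ τ → f (suc j ∷ τ))) (≡.sym (lift-> j<1+n)))) ⟩
      ∑ (perms n) (λ σ → ∑ (insertEverywhere (lift j (suc n)) (map (lift j) σ)) (λ τ → f (suc j ∷ τ)))
        ≈⟨ ∑-cong (perms n) (λ σ → ∑-insertEverywhere-map (lift j) (suc n) σ (λ τ → f (suc j ∷ τ))) ⟩
      ∑ (perms n) (λ σ → ∑ (insertEverywhere (suc n) σ) (λ τ → f (suc j ∷ map (lift j) τ)))
        ≈⟨ ∑-concatMap (insertEverywhere (suc n)) (perms n) _ ⟨
      first j ∎

-- The semiring of formal power series.

module PowerSeries {c ℓ} (R : CommutativeRing c ℓ) where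
  open CommutativeRing R hiding (zero)
  open Relation.Binary.Reasoning.Setoid setoid
  open Algebra.Solver.Ring.NaturalCoefficients.Default commutativeSemiring
    using (solve; _:=_; _:+_; _:*_; con)
  open Sums R

  infix 4 _≋_
  _≋_ : Series R → Series R → Set ℓ
  f ≋ g = ∀ n → f n ≈ g n

  infixl 6 _⊞_
  _⊞_ : Series R → Series R → Series R
  _⊞_ = _⊕_ R

  infixl 7 _⋆_
  _⋆_ : Series R → Series R → Series R
  _⋆_ = _⊛_ R

  𝟘 𝟙 : Series R
  𝟘 _ = 0#
  𝟙 zero = 1#
  𝟙 (suc _) = 0#

  ⋆-suc : ∀ f g n → (f ⋆ g) (suc n) ≈ f 0 * g (suc n) + ((f ∘ suc) ⋆ g) n
  ⋆-suc f g n = ∑-upTo-suc (suc n) (λ i → f i * g (suc n ∸ i))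

  -- Peels the convolution at the end opposite to `⋆-suc`; commutativity is the induction that
  -- matches the two.
  ⋆-suc-last : ∀ f g n → (f ⋆ g) (suc n) ≈ (f ⋆ (g ∘ suc)) n + f (suc n) * g 0
  ⋆-suc-last f g zero = solve 2 (λ x y → x :+ (y :+ con 0) := x :+ con 0 :+ y) refl (f 0 * g 1) (f 1 * g 0)
  ⋆-suc-last f g (suc n) = begin
    (f ⋆ g) (suc (suc n))
      ≈⟨ ⋆-suc f g (suc n) ⟩
    f 0 * g (suc (suc n)) + ((f ∘ suc) ⋆ g) (suc n)
      ≈⟨ +-congˡ (⋆-suc-last (f ∘ suc) g n) ⟩
    f 0 * g (suc (suc n)) + (((f ∘ suc) ⋆ (g ∘ suc)) n + f (suc (suc n)) * g 0)
      ≈⟨ +-assoc _ _ _ ⟨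
    f 0 * g (suc (suc n)) + ((f ∘ suc) ⋆ (g ∘ suc)) n + f (suc (suc n)) * g 0
      ≈⟨ +-congʳ (⋆-suc f (g ∘ suc) n) ⟨
    (f ⋆ (g ∘ suc)) (suc n) + f (suc (suc n)) * g 0 ∎

  ⋆-cong : ∀ {f f′ g g′} → f ≋ f′ → g ≋ g′ → f ⋆ g ≋ f′ ⋆ g′
  ⋆-cong e e′ n = ∑-cong (upTo (suc n)) (λ i → *-cong (e i) (e′ (n ∸ i)))

  ⋆-comm : ∀ f g → f ⋆ g ≋ g ⋆ f
  ⋆-comm f g zero = +-congʳ (*-comm _ _)
  ⋆-comm f g (suc n) = begin
    (f ⋆ g) (suc n)                              ≈⟨ ⋆-suc f g n ⟩
    f 0 * g (suc n) + ((f ∘ suc) ⋆ g) n          ≈⟨ +-cong (*-comm _ _) (⋆-comm (f ∘ suc) g n) ⟩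
    g (suc n) * f 0 + (g ⋆ (f ∘ suc)) n          ≈⟨ +-comm _ _ ⟩
    (g ⋆ (f ∘ suc)) n + g (suc n) * f 0          ≈⟨ ⋆-suc-last g f n ⟨
    (g ⋆ f) (suc n)                              ∎

  ⋆-distribʳ : ∀ h f g → (f ⊞ g) ⋆ h ≋ f ⋆ h ⊞ g ⋆ h
  ⋆-distribʳ h f g n = trans (∑-cong (upTo (suc n)) (λ i → distribʳ _ _ _)) (∑-+ (upTo (suc n)) _ _)

  ⋆-scaleˡ : ∀ a f g n → ((λ i → a * f i) ⋆ g) n ≈ a * (f ⋆ g) n
  ⋆-scaleˡ a f g n = trans (∑-cong (upTo (suc n)) (λ i → *-assoc _ _ _)) (sym (*-∑ a (upTo (suc n)) _))

  ⋆-zeroˡ : ∀ f → 𝟘 ⋆ f ≋ 𝟘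
  ⋆-zeroˡ f n = trans (∑-cong (upTo (suc n)) (λ i → zeroˡ _)) (∑-0 (upTo (suc n)))

  ⋆-identityˡ : ∀ f → 𝟙 ⋆ f ≋ f
  ⋆-identityˡ f zero = trans (+-identityʳ _) (*-identityˡ _)
  ⋆-identityˡ f (suc n) = trans (⋆-suc 𝟙 f n)
    (trans (+-cong (*-identityˡ _) (⋆-zeroˡ f n)) (+-identityʳ _))

  ⋆-assoc : ∀ f g h → (f ⋆ g) ⋆ h ≋ f ⋆ (g ⋆ h)
  ⋆-assoc f g h zero = solve 3 (λ x y z → (x :* y :+ con 0) :* z :+ con 0 := x :* (y :* z :+ con 0) :+ con 0) refl (f 0) (g 0) (h 0)
  ⋆-assoc f g h (suc n) = begin
    ((f ⋆ g) ⋆ h) (suc n)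
      ≈⟨ ⋆-suc (f ⋆ g) h n ⟩
    (f 0 * g 0 + 0#) * h (suc n) + (((f ⋆ g) ∘ suc) ⋆ h) n
      ≈⟨ +-congˡ (⋆-cong {(f ⋆ g) ∘ suc} {λ i → f 0 * g (suc i) + ((f ∘ suc) ⋆ g) i} {h} {h} (⋆-suc f g) (λ _ → refl) n) ⟩
    (f 0 * g 0 + 0#) * h (suc n) + ((λ i → f 0 * g (suc i) + ((f ∘ suc) ⋆ g) i) ⋆ h) n
      ≈⟨ +-congˡ (trans (⋆-distribʳ h (λ i → f 0 * g (suc i)) ((f ∘ suc) ⋆ g) n)
           (+-cong (⋆-scaleˡ (f 0) (g ∘ suc) h n) (⋆-assoc (f ∘ suc) g h n))) ⟩
    (f 0 * g 0 + 0#) * h (suc n) + (f 0 * ((g ∘ suc) ⋆ h) n + ((f ∘ suc) ⋆ (g ⋆ h)) n)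
      ≈⟨ solve 5 (λ x y z s t → (x :* y :+ con 0) :* z :+ (x :* s :+ t) := x :* (y :* z :+ s) :+ t) refl
           (f 0) (g 0) (h (suc n)) (((g ∘ suc) ⋆ h) n) (((f ∘ suc) ⋆ (g ⋆ h)) n) ⟩
    f 0 * (g 0 * h (suc n) + ((g ∘ suc) ⋆ h) n) + ((f ∘ suc) ⋆ (g ⋆ h)) n
      ≈⟨ +-congʳ (*-congˡ (⋆-suc g h n)) ⟨
    f 0 * (g ⋆ h) (suc n) + ((f ∘ suc) ⋆ (g ⋆ h)) n
      ≈⟨ ⋆-suc f (g ⋆ h) n ⟨
    (f ⋆ (g ⋆ h)) (suc n) ∎

  -- Packaged so that the identities of `Quotients`, proved by the semiring solver, apply to series.
  seriesSemiring : CommutativeSemiring c ℓ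
  seriesSemiring = record
    { Carrier = Series R
    ; _≈_ = _≋_
    ; _+_ = _⊞_
    ; _*_ = _⋆_
    ; 0# = 𝟘
    ; 1# = 𝟙
    ; isCommutativeSemiring = isCommutativeSemiringˡ (record
      { +-isCommutativeMonoid = record
        { isMonoid = record
          { isSemigroup = record
            { isMagma = record
              { isEquivalence = ≋-isEquivalence
              ; ∙-cong = λ e e′ n → +-cong (e n) (e′ n)
              }
            ; assoc = λ f g h n → +-assoc _ _ _
            }
          ; identity = (λ f n → +-identityˡ _) , (λ f n → +-identityʳ _)
          }
        ; comm = λ f g n → +-comm _ _
        }
      ; *-isCommutativeMonoid = record
        { isMonoid = record
          { isSemigroup = record
            { isMagma = record
              { isEquivalence = ≋-isEquivalence
              ; ∙-cong = ⋆-cong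
              }
            ; assoc = ⋆-assoc
            }
          ; identity = ⋆-identityˡ , (λ f n → trans (⋆-comm f 𝟙 n) (⋆-identityˡ f n))
          }
        ; comm = ⋆-comm
        }
      ; distribʳ = ⋆-distribʳ
      ; zeroˡ = ⋆-zeroˡ
      })
    }
    where
    ≋-isEquivalence : IsEquivalence _≋_
    ≋-isEquivalence = record { refl = λ _ → refl ; sym = λ e n → sym (e n) ; trans = λ e e′ n → trans (e n) (e′ n) }

  -- The scalar product inside invList is private to Defs. Unification recovers it
  -- from the abstracted goal of inverse1-suc.
  invDot : Series R → ℕ → List Carrier → Carrier
  inverse1-suc : ∀ f n → inverse1 R f (suc n) ≈ - invDot f 1 (invList R f n)
  invDot = _
  inverse1-suc f n with invList R f n | 1
  ... | l | i = refl {x = - invDot f i l}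

  -- `invList f n` runs from coefficient `n` of the inverse down to coefficient 0, so pairing it
  -- with `f i`, `f (suc i)`, ... is a convolution with `f` shifted by `i`.
  invDot-invList : ∀ f i n → invDot f i (invList R f n) ≈ ((λ m → f (i ℕ.+ m)) ⋆ inverse1 R f) n
  invDot-invList f i zero = +-congʳ (*-congʳ (reflexive (≡.cong f (≡.sym (ℕ.+-identityʳ i)))))
  invDot-invList f i (suc n) = begin
    f i * inverse1 R f (suc n) + invDot f (suc i) (invList R f n)
      ≈⟨ +-cong (*-congʳ (reflexive (≡.cong f (≡.sym (ℕ.+-identityʳ i))))) (invDot-invList f (suc i) n) ⟩
    f (i ℕ.+ 0) * inverse1 R f (suc n) + ((λ m → f (suc i ℕ.+ m)) ⋆ inverse1 R f) n
      ≈⟨ +-congˡ (⋆-cong {λ m → f (suc i ℕ.+ m)} {λ m → f (i ℕ.+ suc m)} {inverse1 R f} {inverse1 R f}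
           (λ m → reflexive (≡.cong f (≡.sym (ℕ.+-suc i m)))) (λ _ → refl) n) ⟩
    f (i ℕ.+ 0) * inverse1 R f (suc n) + ((λ m → f (i ℕ.+ suc m)) ⋆ inverse1 R f) n
      ≈⟨ ⋆-suc (λ m → f (i ℕ.+ m)) (inverse1 R f) n ⟨
    ((λ m → f (i ℕ.+ m)) ⋆ inverse1 R f) (suc n) ∎

  ⋆-inverse1 : ∀ f → f 0 ≈ 1# → f ⋆ inverse1 R f ≋ 𝟙
  ⋆-inverse1 f f0 zero = trans (+-identityʳ _) (trans (*-identityʳ _) f0)
  ⋆-inverse1 f f0 (suc n) = begin
    (f ⋆ inverse1 R f) (suc n)
      ≈⟨ ⋆-suc f (inverse1 R f) n ⟩
    f 0 * inverse1 R f (suc n) + ((f ∘ suc) ⋆ inverse1 R f) n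
      ≈⟨ +-cong (trans (*-congʳ f0) (trans (*-identityˡ _)
           (trans (inverse1-suc f n) (-‿cong (invDot-invList f 1 n))))) refl ⟩
    - ((f ∘ suc) ⋆ inverse1 R f) n + ((f ∘ suc) ⋆ inverse1 R f) n
      ≈⟨ -‿inverseˡ _ ⟩
    0# ∎

-- Solving the functional equations by division.

module Quotients {c ℓ} (S : CommutativeSemiring c ℓ) where
  open CommutativeSemiring S
  open Relation.Binary.Reasoning.Setoid setoid
  open Algebra.Solver.Ring.NaturalCoefficients.Default S
    using (solve; _:=_; _:+_; _:*_; con)

  divide : ∀ p p⁻¹ f g → p * p⁻¹ ≈ 1# → p * f ≈ g → f ≈ p⁻¹ * g
  divide p p⁻¹ f g inverse e = begin
    f               ≈⟨ *-identityˡ f ⟨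
    1# * f          ≈⟨ *-congʳ inverse ⟨
    p * p⁻¹ * f     ≈⟨ solve 3 (λ x y z → x :* y :* z := y :* (x :* z)) refl p p⁻¹ f ⟩
    p⁻¹ * (p * f)   ≈⟨ *-congˡ e ⟩
    p⁻¹ * g         ∎

  solution-U : ∀ p p⁻¹ n a u → p * p⁻¹ ≈ 1# → p * n ≈ 1# → p * u ≈ a * n → u ≈ a * (p⁻¹ * p⁻¹)
  solution-U p p⁻¹ n a u inverse en eu = begin
    u                        ≈⟨ divide p p⁻¹ u (a * n) inverse eu ⟩
    p⁻¹ * (a * n)            ≈⟨ *-congˡ (*-congˡ (divide p p⁻¹ n 1# inverse en)) ⟩
    p⁻¹ * (a * (p⁻¹ * 1#))   ≈⟨ solve 2 (λ i a → i :* (a :* (i :* con 1)) := a :* (i :* i)) refl p⁻¹ a ⟩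
    a * (p⁻¹ * p⁻¹)          ∎

  solution-V : ∀ p p⁻¹ n g o b v → p * p⁻¹ ≈ 1# → p * n ≈ 1# → p * o ≈ g * n → p * v ≈ g * o + b * n →
    v ≈ (g * g + p * b) * (p⁻¹ * (p⁻¹ * p⁻¹))
  solution-V p p⁻¹ n g o b v inverse en eo ev = begin
    v
      ≈⟨ divide p p⁻¹ v (g * o + b * n) inverse ev ⟩
    p⁻¹ * (g * o + b * n)
      ≈⟨ *-congˡ (+-cong (*-congˡ (solution-U p p⁻¹ n g o inverse en eo)) (*-congˡ (divide p p⁻¹ n 1# inverse en))) ⟩
    p⁻¹ * (g * (g * (p⁻¹ * p⁻¹)) + b * (p⁻¹ * 1#))
      -- The factor 1 is kept explicit in order to become `p * p⁻¹`, which gives the second term the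
      -- common denominator, the cube of `p`.
      ≈⟨ solve 3 (λ i g b → i :* (g :* (g :* (i :* i)) :+ b :* (i :* con 1)) := g :* g :* (i :* (i :* i)) :+ con 1 :* (b :* (i :* i))) refl p⁻¹ g b ⟩
    g * g * (p⁻¹ * (p⁻¹ * p⁻¹)) + 1# * (b * (p⁻¹ * p⁻¹))
      ≈⟨ +-congˡ (*-congʳ inverse) ⟨
    g * g * (p⁻¹ * (p⁻¹ * p⁻¹)) + p * p⁻¹ * (b * (p⁻¹ * p⁻¹))
      ≈⟨ solve 4 (λ p i g b → g :* g :* (i :* (i :* i)) :+ p :* i :* (b :* (i :* i)) := (g :* g :+ p :* b) :* (i :* (i :* i))) refl p p⁻¹ g b ⟩
    (g * g + p * b) * (p⁻¹ * (p⁻¹ * p⁻¹)) ∎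

-- Weighted sums over the wreath product.

module WreathSeries {c ℓ} (R : CommutativeRing c ℓ) (k : ℕ) (p q r : CommutativeRing.Carrier R)
  (ib : ℕ → CommutativeRing.Carrier R)
  (ib-inverse : ∀ m → CommutativeRing._≈_ R (CommutativeRing._*_ R (pqInt R p q (suc m)) (ib m)) (CommutativeRing.1# R)) where
  open CommutativeRing R hiding (zero)
  open Relation.Binary.Reasoning.Setoid setoid
  open Algebra.Solver.Ring.NaturalCoefficients.Default commutativeSemiring
    using (solve; _:=_; _:+_; _:*_; con)
  open Algebra.Properties.Ring ring using (-1*x≈-x; -‿involutive)
  open Series-defs R k p q r ib
  open Sums R
  open PowerSeries R

  infixr 9 _^_
  _^_ : Carrier → ℕ → Carrier
  _^_ = pow R

  ^-+ : ∀ x m n → x ^ (m ℕ.+ n) ≈ x ^ m * x ^ n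
  ^-+ x zero n = sym (*-identityˡ _)
  ^-+ x (suc m) n = trans (*-congˡ (^-+ x m n)) (sym (*-assoc _ _ _))

  total : ℕ → (List ℕ → List ℕ → Carrier) → Carrier
  total n g = ∑ (perms n) (λ σ → ∑ (words k n) (λ w → weight (σ , w) * g σ w))

  total-cong : ∀ n {g h} → (∀ σ w → g σ w ≈ h σ w) → total n g ≈ total n h
  total-cong n e = ∑-cong (perms n) (λ σ → ∑-cong (words k n) (λ w → *-congˡ (e σ w)))

  total-+ : ∀ n g h → total n (λ σ w → g σ w + h σ w) ≈ total n g + total n h
  total-+ n g h = trans
    (∑-cong (perms n) (λ σ → trans (∑-cong (words k n) (λ w → distribˡ _ _ _)) (∑-+ (words k n) _ _)))
    (∑-+ (perms n) _ _)

  total-0 : ∀ n → total n (λ _ _ → 0#) ≈ 0#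
  total-0 n = trans (∑-cong (perms n) (λ σ → trans (∑-cong (words k n) (λ w → zeroʳ _)) (∑-0 (words k n)))) (∑-0 (perms n))

  total-* : ∀ n a g → total n (λ σ w → a * g σ w) ≈ a * total n g
  total-* n a g = begin
    total n (λ σ w → a * g σ w)
      ≈⟨ ∑-cong (perms n) (λ σ → ∑-cong (words k n) (λ w →
           solve 3 (λ x y z → x :* (y :* z) := y :* (x :* z)) refl (weight (σ , w)) a (g σ w))) ⟩
    ∑ (perms n) (λ σ → ∑ (words k n) (λ w → a * (weight (σ , w) * g σ w)))
      ≈⟨ ∑-cong (perms n) (λ σ → *-∑ a (words k n) _) ⟨
    ∑ (perms n) (λ σ → a * ∑ (words k n) (λ w → weight (σ , w) * g σ w))
      ≈⟨ *-∑ a (perms n) _ ⟨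
    a * total n g ∎

  total-∑ : ∀ {A : Set} n (xs : List A) (g : A → List ℕ → List ℕ → Carrier) →
    total n (λ σ w → ∑ xs (λ x → g x σ w)) ≈ ∑ xs (λ x → total n (g x))
  total-∑ n [] g = total-0 n
  total-∑ n (x ∷ xs) g = trans (total-+ n (g x) _) (+-congˡ (total-∑ n xs g))

  -- The contribution of a first letter of color `x` that is followed by `j` smaller and `n ∸ j`
  -- larger letters.
  first-weight : ℕ → ℕ → ℕ → Carrier
  first-weight n j x = q ^ j * p ^ (n ∸ j) * r ^ x

  weight-first : ∀ {n j σ} x w → j ≤ n → σ ↭ decreasing n →
    weight ((suc j ∷ map (lift j) σ) , (x ∷ w)) ≈ first-weight n j x * weight (σ , w)
  weight-first {n} {j} {σ} x w j≤n s = begin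
    q ^ inv (suc j ∷ map (lift j) σ) * p ^ coinv (suc j ∷ map (lift j) σ) * r ^ (x ℕ.+ norm w)
      ≈⟨ *-cong (*-cong
           (trans (reflexive (≡.cong (q ^_) (inv-first j≤n s))) (^-+ q j (inv σ)))
           (trans (reflexive (≡.cong (p ^_) (coinv-first {j} s))) (^-+ p (n ∸ j) (coinv σ))))
           (^-+ r x (norm w)) ⟩
    (q ^ j * q ^ inv σ) * (p ^ (n ∸ j) * p ^ coinv σ) * (r ^ x * r ^ norm w)
      ≈⟨ solve 6 (λ a b c d e f → a :* b :* (c :* d) :* (e :* f) := a :* c :* e :* (b :* d :* f)) refl
           (q ^ j) (q ^ inv σ) (p ^ (n ∸ j)) (p ^ coinv σ) (r ^ x) (r ^ norm w) ⟩
    first-weight n j x * weight (σ , w) ∎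

  total-first : ∀ n g → total (suc n) g ≈
    ∑ (upTo (suc n)) (λ j → ∑ (upTo k) (λ x →
      first-weight n j x * total n (λ σ w → g (suc j ∷ map (lift j) σ) (x ∷ w))))
  total-first n g = trans (∑-perms-first n (λ σ → ∑ (words k (suc n)) (λ w → weight (σ , w) * g σ w)))
    (∑-upTo-cong (suc n) (λ { j (s≤s j≤n) → inner j j≤n }))
    where
    inner : ∀ j → j ≤ n →
      ∑ (perms n) (λ σ → ∑ (words k (suc n)) (λ w → weight ((suc j ∷ map (lift j) σ) , w) * g (suc j ∷ map (lift j) σ) w))
      ≈ ∑ (upTo k) (λ x → first-weight n j x * total n (λ σ w → g (suc j ∷ map (lift j) σ) (x ∷ w)))
    inner j j≤n = begin
      ∑ (perms n) (λ σ → ∑ (words k (suc n)) (h σ))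
        ≈⟨ ∑-cong (perms n) (λ σ → trans (∑-concatMap _ (upTo k) (h σ)) (∑-cong (upTo k) (λ x → ∑-map (x ∷_) (words k n) (h σ)))) ⟩
      ∑ (perms n) (λ σ → ∑ (upTo k) (λ x → ∑ (words k n) (λ w → h σ (x ∷ w))))
        ≈⟨ ∑-swap (perms n) (upTo k) _ ⟩
      ∑ (upTo k) (λ x → ∑ (perms n) (λ σ → ∑ (words k n) (λ w → h σ (x ∷ w))))
        ≈⟨ ∑-cong (upTo k) (λ x → ∑-cong-All (All.map (λ s → ∑-cong (words k n) (λ w →
             trans (*-congʳ (weight-first x w j≤n s)) (*-assoc _ _ _))) (perms-↭ n))) ⟩
      ∑ (upTo k) (λ x → ∑ (perms n) (λ σ → ∑ (words k n) (λ w →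
        first-weight n j x * (weight (σ , w) * g (suc j ∷ map (lift j) σ) (x ∷ w)))))
        ≈⟨ ∑-cong (upTo k) (λ x → trans
             (∑-cong (perms n) (λ σ → sym (*-∑ (first-weight n j x) (words k n) _)))
             (sym (*-∑ (first-weight n j x) (perms n) _))) ⟩
      ∑ (upTo k) (λ x → first-weight n j x * total n (λ σ w → g (suc j ∷ map (lift j) σ) (x ∷ w))) ∎
      where
      h : List ℕ → List ℕ → Carrier
      h σ w = weight ((suc j ∷ map (lift j) σ) , w) * g (suc j ∷ map (lift j) σ) w

  -- Expansion by the first letter exposes nonempty lists, a positive first value and the length of
  -- the tail, which pointwise congruence over arbitrary lists would hide.
  total-cong-suc : ∀ n {g h} →
    (∀ j x σ w → length σ ≡ n → g (suc j ∷ σ) (x ∷ w) ≈ h (suc j ∷ σ) (x ∷ w)) → total (suc n) g ≈ total (suc n) h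
  total-cong-suc n {g} {h} e = trans (total-first n g) (trans
    (∑-cong (upTo (suc n)) (λ j → ∑-cong (upTo k) (λ x → *-congˡ (
      ∑-cong-All (All.map (λ {σ} s → ∑-cong (words k n) (λ w → *-congˡ
        (e j x (map (lift j) σ) w (≡.trans (length-map (lift j) σ) (length-perm s))))) (perms-↭ n))))))
    (sym (total-first n h)))

  -- Counting leading runs of rises.

  -- block b Φ j x: the first b letters are positioned after (j , x) in an unbroken run of rises,
  -- and Φ is applied to the rises of what remains.
  block : ℕ → (List Bool → Carrier) → ℕ → ℕ → List ℕ → List ℕ → Carrier
  block zero Φ j x σ w = Φ (ris σ w)
  block (suc b) Φ j x (a ∷ σ) (y ∷ w) = ⟦ (j <ᵇ a) ∧ (x ≤ᵇ y) ⟧ * block b Φ a y σ w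
  block (suc b) Φ j x _ _ = 0#

  block-lift : ∀ b Φ i j x σ w → block b Φ (lift i j) x (map (lift i) σ) w ≈ block b Φ j x σ w
  block-lift zero Φ i j x σ w = reflexive (≡.cong Φ (ris-lift i σ w))
  block-lift (suc b) Φ i j x [] w = refl
  block-lift (suc b) Φ i j x (a ∷ σ) [] = refl
  block-lift (suc b) Φ i j x (a ∷ σ) (y ∷ w) = *-cong
    (reflexive (≡.cong (λ s → ⟦ s ∧ (x ≤ᵇ y) ⟧) (lift-<ᵇ i j a))) (block-lift b Φ i a y σ w)

  -- Once the first letter `suc j` is removed and the rest is renumbered, `j` can stand in for it as
  -- the lower bound of the next letter.
  block-suc-lift : ∀ b Φ j x σ w → block b Φ (suc j) x (map (lift j) σ) w ≈ block b Φ j x σ w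
  block-suc-lift zero Φ j x σ w = reflexive (≡.cong Φ (ris-lift j σ w))
  block-suc-lift (suc b) Φ j x [] w = refl
  block-suc-lift (suc b) Φ j x (a ∷ σ) [] = refl
  block-suc-lift (suc b) Φ j x (a ∷ σ) (y ∷ w) = *-cong
    (reflexive (≡.cong (λ s → ⟦ s ∧ (x ≤ᵇ y) ⟧) (suc<ᵇlift j a))) (block-lift b Φ j a y σ w)

  -- p^(b choose 2) times the (p,q)-binomial coefficient [n choose b], so that the recurrence needs no p^(n-b)
  pqBinom : ℕ → ℕ → Carrier
  pqBinom n zero = 1#
  pqBinom zero (suc b) = 0#
  pqBinom (suc n) (suc b) = q ^ suc b * pqBinom n (suc b) + p ^ n * pqBinom n b

  pqBinom-zero : ∀ {n b} → n < b → pqBinom n b ≈ 0#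
  pqBinom-zero {zero} {suc b} _ = refl
  pqBinom-zero {suc n} {suc b} (s≤s n<b) = trans
    (+-cong (trans (*-congˡ (pqBinom-zero (ℕ.m<n⇒m<1+n n<b))) (zeroʳ _)) (trans (*-congˡ (pqBinom-zero n<b)) (zeroʳ _)))
    (+-identityˡ 0#)

  gauss-zero : ∀ {n b} → n < b → gauss R r n b ≈ 0#
  gauss-zero {zero} {suc b} _ = refl
  gauss-zero {suc n} {suc b} (s≤s n<b) = trans
    (+-cong (gauss-zero n<b) (trans (*-congˡ (gauss-zero (ℕ.m<n⇒m<1+n n<b))) (zeroʳ _)))
    (+-identityˡ 0#)

  ^-* : ∀ x a b → x ^ (a ℕ.* suc b) ≈ x ^ a * x ^ (a ℕ.* b)
  ^-* x a b = trans (reflexive (≡.cong (x ^_) (ℕ.*-suc a b))) (^-+ x a (a ℕ.* b))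

  -- The total weight of the increasing runs of `b` letters above `j` at the front of a permutation
  -- of 1, ..., n, relative to what follows. Each run letter precedes all `j` values that are at
  -- most `j`, whence the power of `q`.
  runs-perm : ℕ → ℕ → ℕ → Carrier
  runs-perm b n j = q ^ (j ℕ.* b) * pqBinom (n ∸ j) b

  -- The generating function by sum of the weakly increasing words of length `b` with letters from
  -- `x` to `k` minus 1; subtracting `x` from every letter gives the power of `r`.
  runs-word : ℕ → ℕ → Carrier
  runs-word b x = r ^ (x ℕ.* b) * gauss R r (b ℕ.+ (k ∸ x) ∸ 1) b

  -- The decrease of `runs-perm (suc b) (suc n)` from `i` to `suc i` accounts for the runs with
  -- first letter exactly `suc i`. This is the recurrence of `pqBinom`, so the sum over first
  -- letters above `j` telescopes.
  runs-perm-suc : ∀ b n j → j ≤ suc n →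
    ∑ (upTo (suc n)) (λ i → ⟦ j <ᵇ suc i ⟧ * (q ^ i * p ^ (n ∸ i) * runs-perm b n i)) ≈ runs-perm (suc b) (suc n) j
  runs-perm-suc b n j = ∑-telescope (suc n) j {runs-perm (suc b) (suc n)} (λ { i (s≤s i≤n) → step i i≤n })
    -- No letter exceeds `suc n`, so no nonempty run can start there.
    (trans (*-congˡ (pqBinom-zero {suc n ∸ suc n} (s≤s (ℕ.≤-trans (ℕ.≤-reflexive (ℕ.n∸n≡0 n)) z≤n)))) (zeroʳ _))
    where
    step : ∀ i → i ≤ n →
      runs-perm (suc b) (suc n) i ≈ q ^ i * p ^ (n ∸ i) * runs-perm b n i + runs-perm (suc b) (suc n) (suc i)
    step i i≤n = begin
      q ^ (i ℕ.* suc b) * pqBinom (suc n ∸ i) (suc b)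
        ≈⟨ *-congˡ (reflexive (≡.cong (λ m → pqBinom m (suc b)) (ℕ.+-∸-assoc 1 i≤n))) ⟩
      q ^ (i ℕ.* suc b) * (q ^ suc b * pqBinom (n ∸ i) (suc b) + p ^ (n ∸ i) * pqBinom (n ∸ i) b)
        ≈⟨ distribˡ _ _ _ ⟩
      q ^ (i ℕ.* suc b) * (q ^ suc b * pqBinom (n ∸ i) (suc b)) + q ^ (i ℕ.* suc b) * (p ^ (n ∸ i) * pqBinom (n ∸ i) b)
        ≈⟨ +-cong
             (solve 3 (λ u v w → u :* (v :* w) := v :* u :* w) refl (q ^ (i ℕ.* suc b)) (q ^ suc b) (pqBinom (n ∸ i) (suc b)))
             (trans (*-congʳ (^-* q i b)) (solve 4 (λ u v w z → u :* v :* (w :* z) := u :* w :* (v :* z)) refl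
               (q ^ i) (q ^ (i ℕ.* b)) (p ^ (n ∸ i)) (pqBinom (n ∸ i) b))) ⟩
      q ^ suc b * q ^ (i ℕ.* suc b) * pqBinom (n ∸ i) (suc b) + q ^ i * p ^ (n ∸ i) * runs-perm b n i
        ≈⟨ +-congʳ (*-congʳ (^-+ q (suc b) (i ℕ.* suc b))) ⟨
      runs-perm (suc b) (suc n) (suc i) + q ^ i * p ^ (n ∸ i) * runs-perm b n i
        ≈⟨ +-comm _ _ ⟩
      q ^ i * p ^ (n ∸ i) * runs-perm b n i + runs-perm (suc b) (suc n) (suc i) ∎

  runs-word-suc : ∀ b x → x ≤ k →
    ∑ (upTo k) (λ y → ⟦ x <ᵇ suc y ⟧ * (r ^ y * runs-word b y)) ≈ runs-word (suc b) x
  runs-word-suc b x = ∑-telescope k x {runs-word (suc b)} step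
    (trans (*-congˡ (gauss-zero {b ℕ.+ (k ∸ k)} (s≤s (ℕ.≤-reflexive (≡.trans (≡.cong (b ℕ.+_) (ℕ.n∸n≡0 k)) (ℕ.+-identityʳ b)))))) (zeroʳ _))
    where
    step′ : ∀ y d → k ∸ y ≡ suc d → k ∸ suc y ≡ d →
      runs-word (suc b) y ≈ r ^ y * runs-word b y + runs-word (suc b) (suc y)
    step′ y d e e′ = begin
      r ^ (y ℕ.* suc b) * gauss R r (b ℕ.+ (k ∸ y)) (suc b)
        ≈⟨ *-congˡ (reflexive (≡.cong (λ m → gauss R r m (suc b)) (≡.trans (≡.cong (b ℕ.+_) e) (ℕ.+-suc b d)))) ⟩
      r ^ (y ℕ.* suc b) * (gauss R r (b ℕ.+ d) b + r ^ suc b * gauss R r (b ℕ.+ d) (suc b))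
        ≈⟨ trans (distribˡ _ _ _) (+-cong (trans (*-congʳ (^-* r y b)) (*-assoc _ _ _))
             (trans (sym (*-assoc _ _ _)) (*-congʳ (trans (*-comm _ _) (sym (^-+ r (suc b) (y ℕ.* suc b))))))) ⟩
      r ^ y * (r ^ (y ℕ.* b) * gauss R r (b ℕ.+ d) b) + r ^ (suc y ℕ.* suc b) * gauss R r (b ℕ.+ d) (suc b)
        ≈⟨ +-cong
             (*-congˡ (*-congˡ (reflexive (≡.cong (λ m → gauss R r (m ∸ 1) b) (≡.sym (≡.trans (≡.cong (b ℕ.+_) e) (ℕ.+-suc b d)))))))
             (*-congˡ (reflexive (≡.cong (λ m → gauss R r (b ℕ.+ m) (suc b)) (≡.sym e′)))) ⟩
      r ^ y * runs-word b y + runs-word (suc b) (suc y) ∎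
    step : ∀ y → y < k → runs-word (suc b) y ≈ r ^ y * runs-word b y + runs-word (suc b) (suc y)
    step y y<k = step′ y (k ∸ suc y) (ℕ.+-∸-assoc 1 y<k) ≡.refl

  -- Brings the weak comparison of colors into the form that `∑-telescope` expects.
  ≤ᵇ-<ᵇ : ∀ x y → (x ≤ᵇ y) ≡ (x <ᵇ suc y)
  ≤ᵇ-<ᵇ zero y = ≡.refl
  ≤ᵇ-<ᵇ (suc x) y = ≡.refl

  -- The run is removed letter by letter. The value and the color of the next letter enter through
  -- separate factors, so the double sum splits into those of `runs-perm-suc` and `runs-word-suc`;
  -- the part after the run is unconstrained and stays as a smaller `total`.
  total-block : ∀ b n Φ j x → b ≤ n → j ≤ n → x ≤ k →
    total n (block b Φ j x) ≈ runs-perm b n j * runs-word b x * total (n ∸ b) (λ σ w → Φ (ris σ w))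
  total-block zero n Φ j x _ _ _ = sym (begin
    q ^ (j ℕ.* 0) * 1# * (r ^ (x ℕ.* 0) * 1#) * total n (λ σ w → Φ (ris σ w))
      ≈⟨ *-congʳ (*-cong (*-congʳ (reflexive (≡.cong (q ^_) (ℕ.*-zeroʳ j)))) (*-congʳ (reflexive (≡.cong (r ^_) (ℕ.*-zeroʳ x))))) ⟩
    1# * 1# * (1# * 1#) * total n (λ σ w → Φ (ris σ w))
      ≈⟨ solve 1 (λ t → con 1 :* con 1 :* (con 1 :* con 1) :* t := t) refl _ ⟩
    total n (λ σ w → Φ (ris σ w)) ∎)
  total-block (suc b) (suc n) Φ j x (s≤s b≤n) j≤n x≤k = begin
    total (suc n) (block (suc b) Φ j x)
      ≈⟨ total-first n (block (suc b) Φ j x) ⟩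
    ∑ (upTo (suc n)) (λ i → ∑ (upTo k) (λ y → first-weight n i y *
      total n (λ σ w → ⟦ (j <ᵇ suc i) ∧ (x ≤ᵇ y) ⟧ * block b Φ (suc i) y (map (lift i) σ) w)))
      ≈⟨ ∑-upTo-cong (suc n) (λ { i (s≤s i≤n) → ∑-upTo-cong k (λ y y<k → term i y i≤n (ℕ.<⇒≤ y<k)) }) ⟩
    ∑ (upTo (suc n)) (λ i → ∑ (upTo k) (λ y → F i * (W y * T)))
      ≈⟨ ∑-cong (upTo (suc n)) (λ i → trans (sym (*-∑ (F i) (upTo k) _)) (*-congˡ (sym (∑-* (upTo k) W T)))) ⟩
    ∑ (upTo (suc n)) (λ i → F i * (∑ (upTo k) W * T))
      ≈⟨ ∑-* (upTo (suc n)) F _ ⟨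
    ∑ (upTo (suc n)) F * (∑ (upTo k) W * T)
      ≈⟨ *-cong (runs-perm-suc b n j j≤n) (*-congʳ (runs-word-suc b x x≤k)) ⟩
    runs-perm (suc b) (suc n) j * (runs-word (suc b) x * T)
      ≈⟨ *-assoc _ _ _ ⟨
    runs-perm (suc b) (suc n) j * runs-word (suc b) x * T ∎
    where
    T : Carrier
    T = total (n ∸ b) (λ σ w → Φ (ris σ w))
    F W : ℕ → Carrier
    F i = ⟦ j <ᵇ suc i ⟧ * (q ^ i * p ^ (n ∸ i) * runs-perm b n i)
    W y = ⟦ x <ᵇ suc y ⟧ * (r ^ y * runs-word b y)
    term : ∀ i y → i ≤ n → y ≤ k → first-weight n i y *
      total n (λ σ w → ⟦ (j <ᵇ suc i) ∧ (x ≤ᵇ y) ⟧ * block b Φ (suc i) y (map (lift i) σ) w) ≈ F i * (W y * T)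
    term i y i≤n y≤k = begin
      first-weight n i y * total n (λ σ w → ⟦ (j <ᵇ suc i) ∧ (x ≤ᵇ y) ⟧ * block b Φ (suc i) y (map (lift i) σ) w)
        ≈⟨ *-congˡ (trans (total-cong n (λ σ w → *-cong
             (trans (⟦⟧-∧ (j <ᵇ suc i) (x ≤ᵇ y)) (*-congˡ (reflexive (≡.cong ⟦_⟧ (≤ᵇ-<ᵇ x y)))))
             (block-suc-lift b Φ i y σ w))) (total-* n _ _)) ⟩
      first-weight n i y * (⟦ j <ᵇ suc i ⟧ * ⟦ x <ᵇ suc y ⟧ * total n (block b Φ i y))
        ≈⟨ *-congˡ (*-congˡ (total-block b n Φ i y b≤n i≤n y≤k)) ⟩
      first-weight n i y * (⟦ j <ᵇ suc i ⟧ * ⟦ x <ᵇ suc y ⟧ * (runs-perm b n i * runs-word b y * T))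
        ≈⟨ solve 8 (λ a b c d e f g t → a :* b :* c :* (d :* e :* (f :* g :* t)) := d :* (a :* b :* f) :* (e :* (c :* g) :* t)) refl
             (q ^ i) (p ^ (n ∸ i)) (r ^ y) ⟦ j <ᵇ suc i ⟧ ⟦ x <ᵇ suc y ⟧ (runs-perm b n i) (runs-word b y) T ⟩
      F i * (W y * T) ∎

  -- Alternating sums over leading runs.

  ε : Carrier
  ε = - 1#

  -- Signs are written as products with `ε`, which the semiring solver treats as a variable;
  -- cancellations go through `ε*ε` and `x+ε*x`.
  ε*≈- : ∀ x → ε * x ≈ - x
  ε*≈- = -1*x≈-x

  ε*ε : ε * ε ≈ 1#
  ε*ε = trans (ε*≈- ε) (-‿involutive 1#)

  x+ε*x : ∀ x → x + ε * x ≈ 0#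
  x+ε*x x = trans (+-congˡ (ε*≈- x)) (-‿inverseʳ x)

  -- The alternating sum over b of c b times Φ of what follows a leading run of b + 1 letters,
  -- where the run has to consist of rises only and the step leaving it is unconstrained.
  leadingRuns : (ℕ → Carrier) → (List Bool → Carrier) → List Bool → Carrier
  leadingRuns c Φ [] = c 0 * Φ []
  leadingRuns c Φ (t ∷ l) = c 0 * Φ l + ε * (⟦ t ⟧ * leadingRuns (c ∘ suc) Φ l)

  ris-[] : ∀ σ → ris σ [] ≡ []
  ris-[] [] = ≡.refl
  ris-[] (a ∷ []) = ≡.refl
  ris-[] (a ∷ b ∷ σ) = ≡.refl

  -- `leadingRuns` is the Horner form of this sum. Blocks longer than `σ` vanish, so any upper bound
  -- `n` on the length gives the same value.
  leadingRuns-blocks : ∀ c Φ n a y σ w → length σ ≤ n →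
    leadingRuns c Φ (ris (a ∷ σ) (y ∷ w)) ≈ ∑ (upTo (suc n)) (λ b → c b * ε ^ b * block b Φ a y σ w)
  leadingRuns-blocks c Φ n a y [] w _ = sym (trans (∑-upTo-suc n (λ b → c b * ε ^ b * block b Φ a y [] w))
    (trans (+-cong (*-congʳ (*-identityʳ _)) (trans (∑-cong (upTo n) (λ b → zeroʳ _)) (∑-0 (upTo n)))) (+-identityʳ _)))
  leadingRuns-blocks c Φ n a y (a′ ∷ σ) [] _ = sym (trans (∑-upTo-suc n (λ b → c b * ε ^ b * block b Φ a y (a′ ∷ σ) []))
    (trans (+-cong (*-cong (*-identityʳ _) (reflexive (≡.cong Φ (ris-[] (a′ ∷ σ)))))
      (trans (∑-cong (upTo n) (λ b → zeroʳ _)) (∑-0 (upTo n)))) (+-identityʳ _)))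
  leadingRuns-blocks c Φ (suc n) a y (a′ ∷ σ) (y′ ∷ w) (s≤s ℓ≤n) = sym (begin
    ∑ (upTo (suc (suc n))) (λ b → c b * ε ^ b * block b Φ a y (a′ ∷ σ) (y′ ∷ w))
      ≈⟨ ∑-upTo-suc (suc n) (λ b → c b * ε ^ b * block b Φ a y (a′ ∷ σ) (y′ ∷ w)) ⟩
    c 0 * 1# * Φ rest + ∑ (upTo (suc n)) (λ b → c (suc b) * (ε * ε ^ b) * (⟦ t ⟧ * block b Φ a′ y′ σ w))
      ≈⟨ +-cong (*-congʳ (*-identityʳ _)) (trans
           (∑-cong (upTo (suc n)) (λ b → solve 5 (λ u e f s v → u :* (e :* f) :* (s :* v) := e :* s :* (u :* f :* v)) refl
             (c (suc b)) ε (ε ^ b) ⟦ t ⟧ (block b Φ a′ y′ σ w)))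
           (sym (*-∑ (ε * ⟦ t ⟧) (upTo (suc n)) _))) ⟩
    c 0 * Φ rest + ε * ⟦ t ⟧ * ∑ (upTo (suc n)) (λ b → c (suc b) * ε ^ b * block b Φ a′ y′ σ w)
      ≈⟨ +-congˡ (trans (*-assoc _ _ _) (*-congˡ (*-congˡ (sym (leadingRuns-blocks (c ∘ suc) Φ n a′ y′ σ w ℓ≤n))))) ⟩
    c 0 * Φ rest + ε * (⟦ t ⟧ * leadingRuns (c ∘ suc) Φ rest) ∎)
    where
    t = (a <ᵇ a′) ∧ (y ≤ᵇ y′)
    rest = ris (a′ ∷ σ) (y′ ∷ w)

  -- (p,q)-integers and factorials.

  [_] : ℕ → Carrier
  [ n ] = pqInt R p q n

  [suc] : ∀ n → [ suc n ] ≈ p ^ n + q * [ n ]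
  [suc] n = begin
    [ suc n ]
      ≈⟨ ∑-upTo-suc n (λ i → p ^ (n ∸ i) * q ^ i) ⟩
    p ^ n * 1# + ∑ (upTo n) (λ i → p ^ (n ∸ suc i) * (q * q ^ i))
      ≈⟨ +-cong (*-identityʳ _) (∑-cong (upTo n) (λ i →
           solve 3 (λ u v w → u :* (v :* w) := v :* (u :* w)) refl (p ^ (n ∸ suc i)) q (q ^ i))) ⟩
    p ^ n + ∑ (upTo n) (λ i → q * (p ^ (n ∸ suc i) * q ^ i))
      ≈⟨ +-congˡ (*-∑ q (upTo n) _) ⟨
    p ^ n + q * [ n ] ∎

  [+] : ∀ m n → [ m ℕ.+ n ] ≈ p ^ n * [ m ] + q ^ m * [ n ]
  [+] zero n = sym (trans (+-cong (zeroʳ _) (*-identityˡ _)) (+-identityˡ _))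
  [+] (suc m) n = begin
    [ suc (m ℕ.+ n) ]
      ≈⟨ [suc] (m ℕ.+ n) ⟩
    p ^ (m ℕ.+ n) + q * [ m ℕ.+ n ]
      ≈⟨ +-cong (^-+ p m n) (*-congˡ ([+] m n)) ⟩
    p ^ m * p ^ n + q * (p ^ n * [ m ] + q ^ m * [ n ])
      ≈⟨ solve 6 (λ a b c d e f → a :* b :+ c :* (b :* d :+ e :* f) := b :* (a :+ c :* d) :+ c :* e :* f) refl
           (p ^ m) (p ^ n) q [ m ] (q ^ m) [ n ] ⟩
    p ^ n * (p ^ m + q * [ m ]) + q ^ suc m * [ n ]
      ≈⟨ +-congʳ (*-congˡ ([suc] m)) ⟨
    p ^ n * [ suc m ] + q ^ suc m * [ n ] ∎

  1/_! : ℕ → Carrier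
  1/ n ! = invFact R ib n

  1/!-suc : ∀ n → 1/ n ! ≈ [ suc n ] * 1/ suc n !
  1/!-suc n = trans (sym (*-identityˡ _)) (trans (*-congʳ (sym (ib-inverse n))) (*-assoc _ _ _))

  sucC2 : ∀ b → suc b C 2 ≡ b ℕ.+ (b C 2)
  sucC2 b = ≡.trans (≡.sym (nCk+nC[k+1]≡[n+1]C[k+1] b 1)) (≡.cong (ℕ._+ (b C 2)) (nC1≡n b))

  ^-sucC2 : ∀ b → p ^ (suc b C 2) ≈ p ^ b * p ^ (b C 2)
  ^-sucC2 b = trans (reflexive (≡.cong (p ^_) (sucC2 b))) (^-+ p b (b C 2))

  -- The factorial formula for (p,q)-binomials, expressed with inverse factorials. The two terms of
  -- the recurrence leave the factors `[ suc b ]` and `[ suc m ]`, which `[+]` combines into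
  -- `[ suc N ]`, and `ib N` cancels it.
  pqBinom-! : ∀ b m → 1/ (b ℕ.+ m) ! * pqBinom (b ℕ.+ m) b ≈ p ^ (b C 2) * (1/ b ! * 1/ m !)
  pqBinom-! zero m = solve 1 (λ x → x :* con 1 := con 1 :* (con 1 :* x)) refl _
  pqBinom-! (suc b) zero = begin
    ib (b ℕ.+ 0) * 1/ (b ℕ.+ 0) ! * (q ^ suc b * pqBinom (b ℕ.+ 0) (suc b) + p ^ (b ℕ.+ 0) * pqBinom (b ℕ.+ 0) b)
      ≈⟨ *-congˡ (+-congʳ (trans (*-congˡ (pqBinom-zero (s≤s (ℕ.≤-reflexive (ℕ.+-identityʳ b))))) (zeroʳ _))) ⟩
    ib (b ℕ.+ 0) * 1/ (b ℕ.+ 0) ! * (0# + p ^ (b ℕ.+ 0) * pqBinom (b ℕ.+ 0) b)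
      ≈⟨ solve 4 (λ u v w z → u :* v :* (con 0 :+ w :* z) := u :* w :* (v :* z)) refl
           (ib (b ℕ.+ 0)) (1/ (b ℕ.+ 0) !) (p ^ (b ℕ.+ 0)) (pqBinom (b ℕ.+ 0) b) ⟩
    ib (b ℕ.+ 0) * p ^ (b ℕ.+ 0) * (1/ (b ℕ.+ 0) ! * pqBinom (b ℕ.+ 0) b)
      ≈⟨ *-cong (reflexive (≡.cong (λ n → ib n * p ^ n) (ℕ.+-identityʳ b))) (pqBinom-! b 0) ⟩
    ib b * p ^ b * (p ^ (b C 2) * (1/ b ! * 1#))
      ≈⟨ solve 4 (λ u v w z → u :* v :* (w :* (z :* con 1)) := v :* w :* (u :* z :* con 1)) refl (ib b) (p ^ b) (p ^ (b C 2)) (1/ b !) ⟩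
    p ^ b * p ^ (b C 2) * (1/ suc b ! * 1#)
      ≈⟨ *-congʳ (^-sucC2 b) ⟨
    p ^ (suc b C 2) * (1/ suc b ! * 1#) ∎
  pqBinom-! (suc b) (suc m) = begin
    ib N * 1/ N ! * (q ^ suc b * pqBinom N (suc b) + p ^ N * pqBinom N b)
      ≈⟨ solve 6 (λ i f s x t y → i :* f :* (s :* x :+ t :* y) := i :* (s :* (f :* x) :+ t :* (f :* y))) refl
           (ib N) (1/ N !) (q ^ suc b) (pqBinom N (suc b)) (p ^ N) (pqBinom N b) ⟩
    ib N * (q ^ suc b * (1/ N ! * pqBinom N (suc b)) + p ^ N * (1/ N ! * pqBinom N b))
      ≈⟨ *-congˡ (+-cong
           (*-congˡ (trans (reflexive (≡.cong (λ n → 1/ n ! * pqBinom n (suc b)) (ℕ.+-suc b m)))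
             (trans (pqBinom-! (suc b) m) (*-cong (^-sucC2 b) (*-congˡ (1/!-suc m))))))
           (*-cong (^-+ p b (suc m)) (trans (pqBinom-! b (suc m)) (*-congˡ (*-congʳ (1/!-suc b)))))) ⟩
    ib N * (q ^ suc b * (p ^ b * p ^ (b C 2) * (1/ suc b ! * ([ suc m ] * 1/ suc m !)))
      + p ^ b * p ^ suc m * (p ^ (b C 2) * ([ suc b ] * 1/ suc b ! * 1/ suc m !)))
      ≈⟨ solve 9 (λ i s u v f x g y t →
           i :* (s :* (u :* v :* (f :* (x :* g))) :+ u :* t :* (v :* (y :* f :* g)))
           := (t :* y :+ s :* x) :* i :* (u :* v :* (f :* g))) refl
           (ib N) (q ^ suc b) (p ^ b) (p ^ (b C 2)) (1/ suc b !) [ suc m ] (1/ suc m !) [ suc b ] (p ^ suc m) ⟩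
    (p ^ suc m * [ suc b ] + q ^ suc b * [ suc m ]) * ib N * (p ^ b * p ^ (b C 2) * (1/ suc b ! * 1/ suc m !))
      ≈⟨ *-cong (trans (*-congʳ (sym ([+] (suc b) (suc m)))) (ib-inverse N)) (*-congʳ (sym (^-sucC2 b))) ⟩
    1# * (p ^ (suc b C 2) * (1/ suc b ! * 1/ suc m !))
      ≈⟨ *-identityˡ _ ⟩
    p ^ (suc b C 2) * (1/ suc b ! * 1/ suc m !) ∎
    where
    N : ℕ
    N = b ℕ.+ suc m

  pqBinom-!-∸ : ∀ {b n} → b ≤ n → 1/ n ! * pqBinom n b ≈ p ^ (b C 2) * (1/ b ! * 1/ (n ∸ b) !)
  pqBinom-!-∸ {b} {n} b≤n = trans
    (reflexive (≡.cong (λ m → 1/ m ! * pqBinom m b) (≡.sym (ℕ.m+[n∸m]≡n b≤n)))) (pqBinom-! b (n ∸ b))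

  -- Generating functions of pattern functions.

  egf : (List Bool → Carrier) → Series R
  egf Φ n = 1/ n ! * total n (λ σ w → Φ (ris σ w))

  -- The series `P` without its constant term, with the term of degree `suc i` scaled by `c i`. The
  -- weights `ones`, `index` and `triangle` below give P - 1, G and -H.
  weighted : (ℕ → Carrier) → Series R
  weighted c zero = 0#
  weighted c (suc i) = c i * base (suc i)

  -- By `total-block`, a run of `suc b` letters splits off a (p,q)-binomial, which the factorials
  -- turn into a product of exponential series. In degree 0 the left side would be `c 0 * Φ []`
  -- instead, hence the restriction to `suc n`.
  egf-leadingRuns : ∀ c Φ n → egf (leadingRuns c Φ) (suc n) ≈ ε * (weighted c ⋆ egf Φ) (suc n)
  egf-leadingRuns c Φ n = begin
    1/ suc n ! * total (suc n) (λ σ w → leadingRuns c Φ (ris σ w))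
      -- A virtual letter 0 of color 0 is put in front: the comparison with the actual first letter
      -- always succeeds, so the run of `suc b` letters becomes a block.
      ≈⟨ *-congˡ (total-cong-suc n {λ σ w → leadingRuns c Φ (ris σ w)} {λ σ w → ∑ (upTo (suc n)) (λ b → c b * ε ^ b * block (suc b) Φ 0 0 σ w)} (λ j x σ w e → trans
           (leadingRuns-blocks c Φ n (suc j) x σ w (ℕ.≤-reflexive e))
           (∑-cong (upTo (suc n)) (λ b → *-congˡ {c b * ε ^ b} (sym (*-identityˡ (block b Φ (suc j) x σ w))))))) ⟩
    1/ suc n ! * total (suc n) (λ σ w → ∑ (upTo (suc n)) (λ b → c b * ε ^ b * block (suc b) Φ 0 0 σ w))
      ≈⟨ *-congˡ (trans (total-∑ (suc n) (upTo (suc n)) (λ b σ w → c b * ε ^ b * block (suc b) Φ 0 0 σ w))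
           (∑-cong (upTo (suc n)) (λ b → total-* (suc n) (c b * ε ^ b) (block (suc b) Φ 0 0)))) ⟩
    1/ suc n ! * ∑ (upTo (suc n)) (λ b → c b * ε ^ b * total (suc n) (block (suc b) Φ 0 0))
      ≈⟨ *-∑ (1/ suc n !) (upTo (suc n)) _ ⟩
    ∑ (upTo (suc n)) (λ b → 1/ suc n ! * (c b * ε ^ b * total (suc n) (block (suc b) Φ 0 0)))
      ≈⟨ ∑-upTo-cong (suc n) (λ { b (s≤s b≤n) → term b b≤n }) ⟩
    ∑ (upTo (suc n)) (λ b → ε * (c b * base (suc b) * egf Φ (n ∸ b)))
      ≈⟨ *-∑ ε (upTo (suc n)) _ ⟨
    ε * ∑ (upTo (suc n)) (λ b → c b * base (suc b) * egf Φ (n ∸ b))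
      ≈⟨ *-congˡ (trans (+-congʳ (zeroˡ _)) (+-identityˡ _)) ⟨
    ε * (0# * egf Φ (suc n) + ∑ (upTo (suc n)) (λ b → c b * base (suc b) * egf Φ (n ∸ b)))
      ≈⟨ *-congˡ (∑-upTo-suc (suc n) (λ i → weighted c i * egf Φ (suc n ∸ i))) ⟨
    ε * (weighted c ⋆ egf Φ) (suc n) ∎
    where
    T : ℕ → Carrier
    T b = total (n ∸ b) (λ σ w → Φ (ris σ w))
    term : ∀ b → b ≤ n → 1/ suc n ! * (c b * ε ^ b * total (suc n) (block (suc b) Φ 0 0))
      ≈ ε * (c b * base (suc b) * egf Φ (n ∸ b))
    term b b≤n = begin
      1/ suc n ! * (c b * ε ^ b * total (suc n) (block (suc b) Φ 0 0))
        ≈⟨ *-congˡ (*-congˡ (total-block (suc b) (suc n) Φ 0 0 (s≤s b≤n) z≤n z≤n)) ⟩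
      1/ suc n ! * (c b * ε ^ b * (1# * pqBinom (suc n) (suc b) * (1# * cc (suc b)) * T b))
        ≈⟨ solve 6 (λ f u v x y t → f :* (u :* v :* (con 1 :* x :* (con 1 :* y) :* t)) := u :* v :* (f :* x) :* y :* t) refl
             (1/ suc n !) (c b) (ε ^ b) (pqBinom (suc n) (suc b)) (cc (suc b)) (T b) ⟩
      c b * ε ^ b * (1/ suc n ! * pqBinom (suc n) (suc b)) * cc (suc b) * T b
        ≈⟨ *-congʳ (*-congʳ (*-cong
             -- One of the two inserted signs completes the sign of `base (suc b)`; the other is the
             -- `ε` in front.
             (*-congˡ (trans (sym (*-identityˡ _)) (*-congʳ (sym ε*ε))))
             (pqBinom-!-∸ (s≤s b≤n)))) ⟩
      c b * (ε * ε * ε ^ b) * (p ^ (suc b C 2) * (1/ suc b ! * 1/ (n ∸ b) !)) * cc (suc b) * T b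
        ≈⟨ solve 8 (λ u e v x f g y t → u :* (e :* e :* v) :* (x :* (f :* g)) :* y :* t
             := e :* (u :* (x :* (e :* v) :* f :* y) :* (g :* t))) refl
             (c b) ε (ε ^ b) (p ^ (suc b C 2)) (1/ suc b !) (1/ (n ∸ b) !) (cc (suc b)) (T b) ⟩
      ε * (c b * base (suc b) * egf Φ (n ∸ b)) ∎

  -- In ordinary notation the conclusion is a - s = b - t. It reduces the rise case of the
  -- inductions below to identities without signs.
  transpose : ∀ {a b s t} → a + t ≈ b + s → a + ε * s ≈ b + ε * t
  transpose {a} {b} {s} {t} e = begin
    a + ε * s                    ≈⟨ +-identityʳ _ ⟨
    a + ε * s + 0#               ≈⟨ +-congˡ (x+ε*x t) ⟨
    a + ε * s + (t + ε * t)      ≈⟨ solve 4 (λ a u t v → a :+ u :+ (t :+ v) := a :+ t :+ (u :+ v)) refl a (ε * s) t (ε * t) ⟩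
    a + t + (ε * s + ε * t)      ≈⟨ +-congʳ e ⟩
    b + s + (ε * s + ε * t)      ≈⟨ solve 4 (λ b s u v → b :+ s :+ (u :+ v) := b :+ v :+ (s :+ u)) refl b s (ε * s) (ε * t) ⟩
    b + ε * t + (s + ε * s)      ≈⟨ +-congˡ (x+ε*x s) ⟩
    b + ε * t + 0#               ≈⟨ +-identityʳ _ ⟩
    b + ε * t                    ∎

  -- Recursions for the rise patterns.

  leadingRuns-true : ∀ c Φ l → leadingRuns c Φ (true ∷ l) ≈ c 0 * Φ l + ε * leadingRuns (c ∘ suc) Φ l
  leadingRuns-true c Φ l = +-congˡ (*-congˡ (*-identityˡ _))

  leadingRuns-false : ∀ c Φ l → leadingRuns c Φ (false ∷ l) ≈ c 0 * Φ l
  leadingRuns-false c Φ l = trans (+-congˡ (trans (*-congˡ (zeroˡ _)) (zeroʳ _))) (+-identityʳ _)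

  leadingRuns-cong : ∀ {c d} Φ → (∀ i → c i ≈ d i) → ∀ l → leadingRuns c Φ l ≈ leadingRuns d Φ l
  leadingRuns-cong Φ e [] = *-congʳ (e 0)
  leadingRuns-cong Φ e (t ∷ l) = +-cong (*-congʳ (e 0)) (*-congˡ (*-congˡ (leadingRuns-cong Φ (e ∘ suc) l)))

  leadingRuns-+ : ∀ c d Φ l → leadingRuns (λ i → c i + d i) Φ l ≈ leadingRuns c Φ l + leadingRuns d Φ l
  leadingRuns-+ c d Φ [] = distribʳ _ _ _
  leadingRuns-+ c d Φ (t ∷ l) = trans (+-congˡ (*-congˡ (*-congˡ (leadingRuns-+ (c ∘ suc) (d ∘ suc) Φ l))))
    (solve 7 (λ a b x e s u v → (a :+ b) :* x :+ e :* (s :* (u :+ v)) := a :* x :+ e :* (s :* u) :+ (b :* x :+ e :* (s :* v))) refl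
      (c 0) (d 0) (Φ l) ε ⟦ t ⟧ (leadingRuns (c ∘ suc) Φ l) (leadingRuns (d ∘ suc) Φ l))

  -- A leading rise shifts the weights by one. The shift takes `positive` to `ones` and `index∸1` to
  -- `index`, and it adds `ones` to `index` and `index` to `triangle`; this closes the inductions.
  ones positive index index∸1 triangle : ℕ → Carrier
  ones _ = 1#
  positive zero = 0#
  positive (suc _) = 1#
  index = fromℕ R
  index∸1 i = fromℕ R (i ∸ 1)
  triangle i = fromℕ R (i C 2)

  fromℕ-+ : ∀ m n → fromℕ R (m ℕ.+ n) ≈ fromℕ R m + fromℕ R n
  fromℕ-+ zero n = sym (+-identityˡ _)
  fromℕ-+ (suc m) n = trans (+-congˡ (fromℕ-+ m n)) (sym (+-assoc _ _ _))

  index-split : ∀ i → index i ≈ positive i + index∸1 i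
  index-split zero = sym (+-identityˡ _)
  index-split (suc i) = refl

  triangle-suc : ∀ i → triangle (suc i) ≈ index i + triangle i
  triangle-suc i = trans (reflexive (≡.cong (fromℕ R) (sucC2 i))) (fromℕ-+ i (i C 2))

  none one first later adjacent separated : List Bool → Carrier
  none l = ⟦ noRise l ⟧
  one l = ⟦ oneRise l ⟧
  first l = ⟦ firstRiseOnly l ⟧
  later l = ⟦ laterRiseOnly l ⟧
  adjacent l = ⟦ adjacentRises l ⟧
  separated l = ⟦ separatedRises l ⟧

  -- A leading rise makes the two terms of `leadingRuns` cancel; without one, only the first term is
  -- present.
  none-runs : ∀ l → none l ≈ leadingRuns ones none l
  none-runs [] = sym (*-identityʳ _)
  none-runs (true ∷ l) = sym (begin
    leadingRuns ones none (true ∷ l)            ≈⟨ leadingRuns-true ones none l ⟩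
    1# * none l + ε * leadingRuns ones none l   ≈⟨ +-cong (*-identityˡ _) (*-congˡ (sym (none-runs l))) ⟩
    none l + ε * none l                         ≈⟨ x+ε*x _ ⟩
    0#                                          ∎)
  none-runs (false ∷ l) = sym (trans (leadingRuns-false ones none l) (*-identityˡ _))

  first-runs : ∀ l → first l + leadingRuns positive none l ≈ 0#
  first-runs [] = trans (+-identityˡ _) (zeroˡ _)
  first-runs (true ∷ l) = begin
    none l + leadingRuns positive none (true ∷ l)        ≈⟨ +-congˡ (leadingRuns-true positive none l) ⟩
    none l + (0# * none l + ε * leadingRuns ones none l) ≈⟨ +-congˡ (trans (+-congʳ (zeroˡ _)) (trans (+-identityˡ _) (*-congˡ (sym (none-runs l))))) ⟩
    none l + ε * none l                                  ≈⟨ x+ε*x _ ⟩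
    0#                                                   ∎
  first-runs (false ∷ l) = trans (+-identityˡ _) (trans (leadingRuns-false positive none l) (zeroˡ _))

  -- At a leading rise the shifted weights contribute a second `none l` of opposite sign, and the
  -- rest is the hypothesis for the tail.
  one-runs : ∀ l → one l + leadingRuns index none l ≈ leadingRuns ones one l
  one-runs [] = trans (+-identityˡ _) (trans (zeroˡ _) (sym (zeroʳ _)))
  one-runs (true ∷ l) = begin
    none l + leadingRuns index none (true ∷ l)
      ≈⟨ +-congˡ (trans (leadingRuns-true index none l) (trans (+-congʳ (zeroˡ _)) (+-identityˡ _))) ⟩
    none l + ε * leadingRuns (index ∘ suc) none l
      ≈⟨ +-congˡ (*-congˡ (trans (leadingRuns-+ ones index none l) (+-congʳ (sym (none-runs l))))) ⟩
    none l + ε * (none l + leadingRuns index none l)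
      ≈⟨ transpose (trans (+-congˡ (sym (one-runs l)))
           (solve 3 (λ x y z → x :+ (y :+ z) := y :+ (x :+ z)) refl (none l) (one l) (leadingRuns index none l))) ⟩
    one l + ε * leadingRuns ones one l
      ≈⟨ +-congʳ (*-identityˡ _) ⟨
    1# * one l + ε * leadingRuns ones one l
      ≈⟨ leadingRuns-true ones one l ⟨
    leadingRuns ones one (true ∷ l) ∎
  one-runs (false ∷ l) = trans (+-congˡ (trans (leadingRuns-false index none l) (zeroˡ _)))
    (trans (+-identityʳ _) (sym (trans (leadingRuns-false ones one l) (*-identityˡ _))))

  -- At a leading rise the weights become `index`, one more than `index∸1` on nonzero arguments. By
  -- `first-runs` this excess contributes exactly the `first l` that the pattern requires.
  adjacent-runs : ∀ l → adjacent l ≈ leadingRuns ones adjacent l + leadingRuns index∸1 none l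
  adjacent-runs [] = sym (trans (+-cong (zeroʳ _) (zeroˡ _)) (+-identityˡ _))
  adjacent-runs (true ∷ l) = sym (begin
    leadingRuns ones adjacent (true ∷ l) + leadingRuns index∸1 none (true ∷ l)
      ≈⟨ +-cong (leadingRuns-true ones adjacent l) (leadingRuns-true index∸1 none l) ⟩
    1# * adjacent l + ε * S + (0# * none l + ε * I)
      ≈⟨ solve 5 (λ a e s n i → con 1 :* a :+ e :* s :+ (con 0 :* n :+ e :* i) := a :+ e :* (s :+ i)) refl
           (adjacent l) ε S (none l) I ⟩
    adjacent l + ε * (S + I)
      ≈⟨ transpose (begin
           adjacent l + 0#                     ≈⟨ +-cong (adjacent-runs l) (sym (first-runs l)) ⟩
           S + J + (first l + F)               ≈⟨ solve 4 (λ s j f t → s :+ j :+ (f :+ t) := f :+ (s :+ (t :+ j))) refl S J (first l) F ⟩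
           first l + (S + (F + J))             ≈⟨ +-congˡ (+-congˡ (trans (leadingRuns-cong none index-split l) (leadingRuns-+ positive index∸1 none l))) ⟨
           first l + (S + I)                   ∎) ⟩
    first l + ε * 0#
      ≈⟨ trans (+-congˡ (zeroʳ _)) (+-identityʳ _) ⟩
    first l ∎)
    where
    S I J F : Carrier
    S = leadingRuns ones adjacent l
    I = leadingRuns index none l
    J = leadingRuns index∸1 none l
    F = leadingRuns positive none l
  adjacent-runs (false ∷ l) = sym (trans
    (+-cong (trans (leadingRuns-false ones adjacent l) (*-identityˡ _)) (trans (leadingRuns-false index∸1 none l) (zeroˡ _)))
    (+-identityʳ _))

  -- At a leading rise the shift takes `index∸1` to `index`, and the claim becomes `one-runs` for
  -- the tail.
  later-runs : ∀ l → later l + leadingRuns index∸1 none l ≈ leadingRuns ones one l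
  later-runs [] = trans (+-identityˡ _) (trans (zeroˡ _) (sym (zeroʳ _)))
  later-runs (true ∷ l) = begin
    0# + leadingRuns index∸1 none (true ∷ l)
      ≈⟨ +-congˡ (trans (leadingRuns-true index∸1 none l) (trans (+-congʳ (zeroˡ _)) (+-identityˡ _))) ⟩
    0# + ε * leadingRuns index none l
      ≈⟨ transpose (trans (+-identityˡ _) (sym (one-runs l))) ⟩
    one l + ε * leadingRuns ones one l
      ≈⟨ +-congʳ (*-identityˡ _) ⟨
    1# * one l + ε * leadingRuns ones one l
      ≈⟨ leadingRuns-true ones one l ⟨
    leadingRuns ones one (true ∷ l) ∎
  later-runs (false ∷ l) = trans (+-congˡ (trans (leadingRuns-false index∸1 none l) (zeroˡ _)))
    (trans (+-identityʳ _) (sym (trans (leadingRuns-false ones one l) (*-identityˡ _))))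

  -- At a leading rise, shifting `index` yields an extra `leadingRuns ones one l`, which
  -- `later-runs` exchanges for the required `later l`; shifting `triangle` and `index∸1` yields the
  -- same `index` term on both sides.
  separated-runs : ∀ l → separated l + (leadingRuns index one l + leadingRuns index∸1 none l)
    ≈ leadingRuns ones separated l + leadingRuns triangle none l
  separated-runs [] = solve 0 (con 0 :+ (con 0 :* con 0 :+ con 0 :* con 1) := con 1 :* con 0 :+ con 0 :* con 1) refl
  separated-runs (true ∷ l) = begin
    later l + (leadingRuns index one (true ∷ l) + leadingRuns index∸1 none (true ∷ l))
      ≈⟨ +-congˡ (+-cong
           (trans (leadingRuns-true index one l) (+-congˡ (*-congˡ (leadingRuns-+ ones index one l))))
           (leadingRuns-true index∸1 none l)) ⟩
    later l + (0# * one l + ε * (X + O) + (0# * none l + ε * I))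
      ≈⟨ solve 7 (λ t o e x u n i → t :+ (con 0 :* o :+ e :* (x :+ u) :+ (con 0 :* n :+ e :* i)) := t :+ e :* (x :+ u :+ i)) refl
           (later l) (one l) ε X O (none l) I ⟩
    later l + ε * (X + O + I)
      ≈⟨ transpose (begin
           later l + (S + (I + T))         ≈⟨ solve 4 (λ t s i u → t :+ (s :+ (i :+ u)) := t :+ i :+ (s :+ u)) refl (later l) S I T ⟩
           later l + I + (S + T)           ≈⟨ +-congˡ (separated-runs l) ⟨
           later l + I + (separated l + (O + J)) ≈⟨ solve 5 (λ t i v o j → t :+ i :+ (v :+ (o :+ j)) := v :+ (t :+ j :+ o :+ i)) refl (later l) I (separated l) O J ⟩
           separated l + (later l + J + O + I)   ≈⟨ +-congˡ (+-congʳ (+-congʳ (later-runs l))) ⟩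
           separated l + (X + O + I)       ∎) ⟩
    separated l + ε * (S + (I + T))
      ≈⟨ solve 6 (λ v e s n i t → con 1 :* v :+ e :* s :+ (con 0 :* n :+ e :* (i :+ t)) := v :+ e :* (s :+ (i :+ t))) refl
           (separated l) ε S (none l) I T ⟨
    1# * separated l + ε * S + (0# * none l + ε * (I + T))
      ≈⟨ +-cong (leadingRuns-true ones separated l)
           (trans (leadingRuns-true triangle none l) (+-congˡ (*-congˡ
             (trans (leadingRuns-cong none triangle-suc l) (leadingRuns-+ index triangle none l))))) ⟨
    leadingRuns ones separated (true ∷ l) + leadingRuns triangle none (true ∷ l) ∎
    where
    X O I J S T : Carrier
    X = leadingRuns ones one l
    O = leadingRuns index one l
    I = leadingRuns index none l
    J = leadingRuns index∸1 none l
    S = leadingRuns ones separated l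
    T = leadingRuns triangle none l
  separated-runs (false ∷ l) = begin
    separated l + (leadingRuns index one (false ∷ l) + leadingRuns index∸1 none (false ∷ l))
      ≈⟨ +-congˡ (+-cong (leadingRuns-false index one l) (leadingRuns-false index∸1 none l)) ⟩
    separated l + (0# * one l + 0# * none l)
      ≈⟨ solve 3 (λ v o n → v :+ (con 0 :* o :+ con 0 :* n) := con 1 :* v :+ con 0 :* n) refl (separated l) (one l) (none l) ⟩
    1# * separated l + 0# * none l
      ≈⟨ +-cong (leadingRuns-false ones separated l) (leadingRuns-false triangle none l) ⟨
    leadingRuns ones separated (false ∷ l) + leadingRuns triangle none (false ∷ l) ∎

  -- Functional equations of the generating functions.

  egf-cong : ∀ {Φ Ψ} → (∀ l → Φ l ≈ Ψ l) → egf Φ ≋ egf Ψ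
  egf-cong e n = *-congˡ (total-cong n (λ σ w → e (ris σ w)))

  egf-+ : ∀ Φ Ψ → egf (λ l → Φ l + Ψ l) ≋ egf Φ ⊞ egf Ψ
  egf-+ Φ Ψ n = trans (*-congˡ (total-+ n _ _)) (distribˡ _ _ _)

  egf-* : ∀ a Φ n → egf (λ l → a * Φ l) n ≈ a * egf Φ n
  egf-* a Φ n = trans (*-congˡ (total-* n a _))
    (solve 3 (λ x y z → x :* (y :* z) := y :* (x :* z)) refl (1/ n !) a _)

  egf-zero : ∀ Φ → egf Φ 0 ≈ Φ []
  egf-zero Φ = solve 1 (λ x → con 1 :* (con 1 :* con 1 :* con 1 :* x :+ con 0 :+ con 0) := x) refl (Φ [])

  -- Passes from the filtered lists in the statement to indicators of boolean patterns.
  total-rises : ∀ (test : List ℕ → Bool) (shape : List Bool → Bool) →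
    (∀ i l → test (positions i l) ≡ shape l) → ∀ n →
    1/ n ! * sumL R (map weight (filter (λ x → T? (test (Ris x))) (wreath n k))) ≈ egf (λ l → ⟦ shape l ⟧) n
  total-rises test shape e n = *-congˡ (begin
    ∑ (filter (λ x → T? (test (Ris x))) (wreath n k)) weight
      ≈⟨ ∑-filter (λ x → test (Ris x)) (wreath n k) weight ⟩
    ∑ (wreath n k) (λ x → weight x * ⟦ test (Ris x) ⟧)
      ≈⟨ ∑-concatMap (λ σ → map (σ ,_) (words k n)) (perms n) _ ⟩
    ∑ (perms n) (λ σ → ∑ (map (σ ,_) (words k n)) (λ x → weight x * ⟦ test (Ris x) ⟧))
      ≈⟨ ∑-cong (perms n) (λ σ → trans (∑-map (σ ,_) (words k n) _) (∑-cong (words k n) (λ w →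
           *-congˡ (reflexive (≡.cong ⟦_⟧ (≡.trans (≡.cong test (risesFrom-positions 1 σ w)) (e 1 (ris σ w)))))))) ⟩
    total n (λ σ w → ⟦ shape (ris σ w) ⟧) ∎)

  P-split : P ≋ 𝟙 ⊞ weighted ones
  P-split zero = sym (+-identityʳ _)
  P-split (suc n) = sym (trans (+-identityˡ _) (*-identityˡ _))

  G-weighted : G ≋ weighted index
  G-weighted zero = refl
  G-weighted (suc zero) = sym (zeroˡ _)
  G-weighted (suc (suc n)) = refl

  H-weighted : H ≋ λ n → ε * weighted triangle n
  H-weighted zero = sym (zeroʳ _)
  H-weighted (suc zero) = sym (trans (*-congˡ (zeroˡ _)) (zeroʳ _))
  H-weighted (suc (suc zero)) = sym (trans (*-congˡ (zeroˡ _)) (zeroʳ _))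
  H-weighted (suc (suc (suc n))) = sym (ε*≈- _)

  gauss-one : ∀ n → gauss R r n 1 ≈ rInt R r n
  gauss-one zero = refl
  gauss-one (suc n) = begin
    1# + r * 1# * gauss R r n 1              ≈⟨ +-congˡ (*-cong (*-identityʳ r) (gauss-one n)) ⟩
    1# + r * ∑ (upTo n) (r ^_)               ≈⟨ +-congˡ (*-∑ r (upTo n) _) ⟩
    1# + ∑ (upTo n) (λ i → r * r ^ i)        ≈⟨ ∑-upTo-suc n (r ^_) ⟨
    rInt R r (suc n)                         ∎

  ib-zero : ib 0 ≈ 1#
  ib-zero = trans (solve 1 (λ x → x := (con 1 :* con 1 :+ con 0) :* x) refl (ib 0)) (ib-inverse 0)

  base-one : base 1 ≈ ε * rInt R r k
  base-one = begin
    1# * (ε * 1#) * (ib 0 * 1#) * gauss R r k 1   ≈⟨ *-cong (*-congˡ (*-congʳ ib-zero)) (gauss-one k) ⟩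
    1# * (ε * 1#) * (1# * 1#) * rInt R r k        ≈⟨ solve 2 (λ e x → con 1 :* (e :* con 1) :* (con 1 :* con 1) :* x := e :* x) refl ε (rInt R r k) ⟩
    ε * rInt R r k                                ∎

  numerator-U numerator-V : Series R
  numerator-U = _⊖_ R (_⊕_ R (kt-1 R r k) P) G
  numerator-V = _⊖_ R (_⊖_ R (_⊕_ R H G) (kt-1 R r k)) P

  -‿ε : ∀ x y → x - y ≈ x + ε * y
  -‿ε x y = +-congˡ (sym (ε*≈- y))

  -- Adding `kt-1` cancels the terms of `P` in degrees 0 and 1, by `base-one`. In degree i + 1 with
  -- i at least 1, P - G has the factor 1 - i.
  numerator-U-weighted : numerator-U ≋ λ n → ε * weighted index∸1 n
  numerator-U-weighted zero = begin
    ε + 1# - 0#      ≈⟨ trans (-‿ε _ _) (trans (+-congˡ (zeroʳ _)) (+-identityʳ _)) ⟩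
    ε + 1#           ≈⟨ -‿inverseˡ 1# ⟩
    0#               ≈⟨ zeroʳ ε ⟨
    ε * 0#           ∎
  numerator-U-weighted (suc zero) = begin
    rInt R r k + base 1 - 0#            ≈⟨ trans (-‿ε _ _) (trans (+-congˡ (zeroʳ _)) (+-identityʳ _)) ⟩
    rInt R r k + base 1                 ≈⟨ +-congˡ base-one ⟩
    rInt R r k + ε * rInt R r k         ≈⟨ x+ε*x _ ⟩
    0#                                  ≈⟨ trans (*-congˡ (zeroˡ _)) (zeroʳ ε) ⟨
    ε * (0# * base 1)                   ∎
  numerator-U-weighted (suc (suc n)) = begin
    0# + b - fromℕ R (suc n) * b                     ≈⟨ -‿ε _ _ ⟩
    0# + b + ε * ((1# + f) * b)                      ≈⟨ solve 3 (λ b e f → con 0 :+ b :+ e :* ((con 1 :+ f) :* b) := b :+ e :* b :+ e :* (f :* b)) refl b ε f ⟩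
    b + ε * b + ε * (f * b)                          ≈⟨ trans (+-congʳ (x+ε*x b)) (+-identityˡ _) ⟩
    ε * (f * b)                                      ∎
    where
    b f : Carrier
    b = base (suc (suc n))
    f = fromℕ R n

  -- `numerator-V` is H minus `numerator-U`, so the previous computation is reused.
  numerator-V-weighted : numerator-V ≋ (λ n → ε * weighted triangle n) ⊞ weighted index∸1
  numerator-V-weighted n = begin
    H n + G n - K - P n                        ≈⟨ trans (-‿ε _ _) (+-congʳ (-‿ε _ _)) ⟩
    H n + G n + ε * K + ε * P n                ≈⟨ solve 5 (λ h g e k p → h :+ g :+ e :* k :+ e :* p := h :+ (e :* (k :+ p) :+ g)) refl (H n) (G n) ε K (P n) ⟩
    H n + (ε * (K + P n) + G n)                ≈⟨ +-congˡ (+-congˡ (trans (sym (*-identityˡ _)) (trans (*-congʳ (sym ε*ε)) (*-assoc _ _ _)))) ⟩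
    H n + (ε * (K + P n) + ε * (ε * G n))      ≈⟨ +-congˡ (distribˡ _ _ _) ⟨
    H n + ε * (K + P n + ε * G n)              ≈⟨ +-cong (H-weighted n) (*-congˡ (trans (sym (-‿ε _ _)) (numerator-U-weighted n))) ⟩
    ε * weighted triangle n + ε * (ε * weighted index∸1 n) ≈⟨ +-congˡ (trans (sym (*-assoc _ _ _)) (trans (*-congʳ ε*ε) (*-identityˡ _))) ⟩
    ε * weighted triangle n + weighted index∸1 n ∎
    where
    K : Carrier
    K = kt-1 R r k n

  -- With the weights `ones`, `leadingRuns` acts in positive degrees as multiplication by 1 - P;
  -- moving that term to the left leaves multiplication by `P`.
  P⋆egf : ∀ Φ Ψ → (∀ l → Φ l ≈ leadingRuns ones Φ l + Ψ l) → ∀ n → (P ⋆ egf Φ) (suc n) ≈ egf Ψ (suc n)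
  P⋆egf Φ Ψ e n = begin
    (P ⋆ egf Φ) (suc n)
      ≈⟨ ⋆-cong {g = egf Φ} P-split (λ _ → refl) (suc n) ⟩
    ((𝟙 ⊞ weighted ones) ⋆ egf Φ) (suc n)
      ≈⟨ trans (⋆-distribʳ (egf Φ) 𝟙 (weighted ones) (suc n)) (+-congʳ (⋆-identityˡ (egf Φ) (suc n))) ⟩
    egf Φ (suc n) + W
      ≈⟨ +-congʳ (trans (egf-cong e (suc n)) (trans (egf-+ (leadingRuns ones Φ) Ψ (suc n)) (+-congʳ (egf-leadingRuns ones Φ n)))) ⟩
    ε * W + egf Ψ (suc n) + W
      ≈⟨ solve 3 (λ u v w → u :+ v :+ w := w :+ u :+ v) refl (ε * W) (egf Ψ (suc n)) W ⟩
    W + ε * W + egf Ψ (suc n)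
      ≈⟨ trans (+-congʳ (x+ε*x W)) (+-identityˡ _) ⟩
    egf Ψ (suc n) ∎
    where
    W : Carrier
    W = (weighted ones ⋆ egf Φ) (suc n)

  P⋆none : P ⋆ egf none ≋ 𝟙
  P⋆none zero = trans (+-identityʳ _) (trans (*-identityˡ _) (egf-zero none))
  P⋆none (suc n) = trans (P⋆egf none (λ _ → 0#) (λ l → trans (none-runs l) (sym (+-identityʳ _))) n)
    (trans (*-congˡ (total-0 (suc n))) (zeroʳ _))

  -- Handles degree 0, which `P⋆egf` leaves out: both constant terms vanish.
  P⋆-zero : ∀ (f g h : Series R) → g 0 ≈ 0# → f 0 ≈ 0# → (P ⋆ f) 0 ≈ (g ⋆ h) 0
  P⋆-zero f g h g0 f0 = +-congʳ (trans (*-congˡ f0) (trans (zeroʳ _) (sym (trans (*-congʳ g0) (zeroˡ _)))))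

  P⋆one : P ⋆ egf one ≋ G ⋆ egf none
  P⋆one zero = P⋆-zero (egf one) G (egf none) refl (egf-zero one)
  P⋆one (suc n) = begin
    (P ⋆ egf one) (suc n)
      ≈⟨ P⋆egf one (λ l → ε * leadingRuns index none l) split n ⟩
    egf (λ l → ε * leadingRuns index none l) (suc n)
      ≈⟨ trans (egf-* ε (leadingRuns index none) (suc n)) (*-congˡ (egf-leadingRuns index none n)) ⟩
    ε * (ε * (weighted index ⋆ egf none) (suc n))
      ≈⟨ trans (sym (*-assoc _ _ _)) (trans (*-congʳ ε*ε) (*-identityˡ _)) ⟩
    (weighted index ⋆ egf none) (suc n)
      ≈⟨ ⋆-cong {g = egf none} G-weighted (λ _ → refl) (suc n) ⟨
    (G ⋆ egf none) (suc n) ∎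
    where
    split : ∀ l → one l ≈ leadingRuns ones one l + ε * leadingRuns index none l
    split l = begin
      one l                                 ≈⟨ trans (+-congˡ (zeroʳ ε)) (+-identityʳ _) ⟨
      one l + ε * 0#                        ≈⟨ transpose (trans (one-runs l) (sym (+-identityʳ _))) ⟩
      leadingRuns ones one l + ε * leadingRuns index none l ∎

  P⋆adjacent : P ⋆ egf adjacent ≋ numerator-U ⋆ egf none
  P⋆adjacent zero = P⋆-zero (egf adjacent) numerator-U (egf none)
    (trans (numerator-U-weighted 0) (zeroʳ ε)) (egf-zero adjacent)
  P⋆adjacent (suc n) = begin
    (P ⋆ egf adjacent) (suc n)
      ≈⟨ P⋆egf adjacent (leadingRuns index∸1 none) adjacent-runs n ⟩
    egf (leadingRuns index∸1 none) (suc n)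
      ≈⟨ egf-leadingRuns index∸1 none n ⟩
    ε * (weighted index∸1 ⋆ egf none) (suc n)
      ≈⟨ ⋆-scaleˡ ε (weighted index∸1) (egf none) (suc n) ⟨
    ((λ i → ε * weighted index∸1 i) ⋆ egf none) (suc n)
      ≈⟨ ⋆-cong {g = egf none} numerator-U-weighted (λ _ → refl) (suc n) ⟨
    (numerator-U ⋆ egf none) (suc n) ∎

  P⋆separated : P ⋆ egf separated ≋ G ⋆ egf one ⊞ numerator-V ⋆ egf none
  P⋆separated zero = trans
    (P⋆-zero (egf separated) numerator-V (egf none)
      (trans (numerator-V-weighted 0) (trans (+-identityʳ _) (zeroʳ ε))) (egf-zero separated))
    (sym (trans (+-congʳ (trans (+-congʳ (zeroˡ _)) (+-identityˡ _))) (+-identityˡ _)))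
  P⋆separated (suc n) = begin
    (P ⋆ egf separated) (suc n)
      ≈⟨ P⋆egf separated Ψ split n ⟩
    egf Ψ (suc n)
      ≈⟨ trans (egf-+ T (λ l → ε * (O l + J l)) (suc n)) (+-congˡ (trans
           (egf-* ε (λ l → O l + J l) (suc n)) (*-congˡ (egf-+ O J (suc n))))) ⟩
    egf T (suc n) + ε * (egf O (suc n) + egf J (suc n))
      ≈⟨ +-cong (egf-leadingRuns triangle none n)
           (*-congˡ (+-cong (egf-leadingRuns index one n) (egf-leadingRuns index∸1 none n))) ⟩
    ε * t + ε * (ε * o + ε * j)
      -- The `index` and `index∸1` terms carry two signs, which cancel; the `triangle` term keeps
      -- the single sign of `H`.
      ≈⟨ solve 4 (λ e t o j → e :* t :+ e :* (e :* o :+ e :* j) := e :* e :* o :+ (e :* t :+ e :* e :* j)) refl ε t o j ⟩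
    ε * ε * o + (ε * t + ε * ε * j)
      ≈⟨ +-cong (trans (*-congʳ ε*ε) (*-identityˡ o)) (+-congˡ (trans (*-congʳ ε*ε) (*-identityˡ j))) ⟩
    o + (ε * t + j)
      ≈⟨ +-congˡ (+-congʳ (⋆-scaleˡ ε (weighted triangle) (egf none) (suc n))) ⟨
    o + (((λ i → ε * weighted triangle i) ⋆ egf none) (suc n) + j)
      ≈⟨ +-congˡ (⋆-distribʳ (egf none) (λ i → ε * weighted triangle i) (weighted index∸1) (suc n)) ⟨
    o + (((λ i → ε * weighted triangle i) ⊞ weighted index∸1) ⋆ egf none) (suc n)
      ≈⟨ +-cong (⋆-cong {g = egf one} G-weighted (λ _ → refl) (suc n))
           (⋆-cong {g = egf none} numerator-V-weighted (λ _ → refl) (suc n)) ⟨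
    (G ⋆ egf one) (suc n) + (numerator-V ⋆ egf none) (suc n) ∎
    where
    T O J Ψ : List Bool → Carrier
    T = leadingRuns triangle none
    O = leadingRuns index one
    J = leadingRuns index∸1 none
    Ψ l = T l + ε * (O l + J l)
    t o j : Carrier
    t = (weighted triangle ⋆ egf none) (suc n)
    o = (weighted index ⋆ egf one) (suc n)
    j = (weighted index∸1 ⋆ egf none) (suc n)
    split : ∀ l → separated l ≈ leadingRuns ones separated l + Ψ l
    split l = begin
      separated l                           ≈⟨ trans (+-congˡ (zeroʳ ε)) (+-identityʳ _) ⟨
      separated l + ε * 0#                  ≈⟨ transpose (trans (separated-runs l) (sym (+-identityʳ _))) ⟩
      leadingRuns ones separated l + T l + ε * (O l + J l) ≈⟨ +-assoc _ _ _ ⟩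
      leadingRuns ones separated l + Ψ l    ∎

  -- The closed forms.

  P⋆Pinv : P ⋆ Pinv ≋ 𝟙
  P⋆Pinv = ⋆-inverse1 P refl

  GU-rational : GU ≋ RU
  GU-rational n = trans
    (total-rises isU adjacentRises isU-positions n)
    (solution-U P Pinv (egf none) numerator-U (egf adjacent) P⋆Pinv P⋆none P⋆adjacent n)
    where open Quotients seriesSemiring

  GV-rational : GV ≋ RV
  GV-rational n = trans
    (total-rises isV separatedRises isV-positions n)
    (solution-V P Pinv (egf none) G (egf one) numerator-V (egf separated) P⋆Pinv P⋆none P⋆one P⋆separated n)
    where open Quotients seriesSemiring

theorem15 : ∀ {c ℓ : Level} (R : CommutativeRing c ℓ) (k : ℕ) → 2 ≤ k →
    (p q r : CommutativeRing.Carrier R) (ib : ℕ → CommutativeRing.Carrier R) →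
    (∀ m → CommutativeRing._≈_ R (CommutativeRing._*_ R (pqInt R p q (suc m)) (ib m)) (CommutativeRing.1# R)) →
    (∀ n → CommutativeRing._≈_ R (Series-defs.GU R k p q r ib n) (Series-defs.RU R k p q r ib n))
    × (∀ n → CommutativeRing._≈_ R (Series-defs.GV R k p q r ib n) (Series-defs.RV R k p q r ib n))
theorem15 R k _ p q r ib ib-inverse = GU-rational , GV-rational
  where open WreathSeries R k p q r ib ib-inverse
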